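{- Let $n\ge 4$ be an integer and let $V=\mathbb{F}_2^n$. Let $h:\mathcal{C}(n,2)_2\to\mathcal{G}_2(V)$ be the map which leaves fixed every element of $\mathcal{A}\cup\mathcal{B}$ and sends every $X\in\mathcal{C}$ to $X^c$ (all defined in the context). If an isomorphism $f$ of the graph $\Gamma(n,2)_2$ to a (not necessarily induced) subgraph of the Grassmann graph $\Gamma_2(V)$ cannot be extended to an automorphism of $\Gamma_2(V)$, then $f=gh$ (that is, $f=g\circ h$) for a certain automorphism $g$ of $\Gamma_2(V)$.
   Context: Let $n\ge 4$, let $\mathbb{F}_2$ be the field of two elements and let $V=\mathbb{F}_2^n$. $\mathcal{G}_k(V)$ denotes the set of $k$-dimensional subspaces of $V$. Two distinct $2$-dimensional subspaces of $V$ are adjacent if their intersection is $1$-dimensional. The Grassmann graph $\Gamma_2(V)$ is the simple graph with vertex set $\mathcal{G}_2(V)$ whose edges join adjacent subspaces. Let $C_i$ be the hyperplane of $V$ formed by all vectors whose $i$-th coordinate is $0$. $\mathcal{C}(n,2)_2$ is the set of non-degenerate linear $[n,2]_2$ codes, i.e. of all $2$-dimensional subspaces of $V$ not contained in any $C_i$, $i\in\{1,\dots,n\}$. $\Gamma(n,2)_2$ is the subgraph of $\Gamma_2(V)$ induced by $\mathcal{C}(n,2)_2$. An isomorphism of $\Gamma(n,2)_2$ to a (not necessarily induced) subgraph of $\Gamma_2(V)$ is the same as an injective map $f:\mathcal{C}(n,2)_2\to\mathcal{G}_2(V)$ sending adjacent elements to adjacent elements. Such $f$ can be extended to an automorphism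 of $\Gamma_2(V)$ if it is the restriction to $\mathcal{C}(n,2)_2$ of some automorphism of $\Gamma_2(V)$. Let $Q$ be the $1$-dimensional subspace of $V$ containing $(1,\dots,1)$. For every non-empty proper subset $I\subset\{1,\dots,n\}$ let $P_I$ be the $1$-dimensional subspace containing the vector whose $i$-th coordinate is $1$ if $i\in I$ and $0$ if $i\notin I$; put $I^c=\{1,\dots,n\}\setminus I$ and $P^I=P_{I^c}$; write $P^i=P^{\{i\}}$. Let $H$ be the hyperplane of $V$ spanned by $P^1,\dots,P^{n-1}$. One has $Q\not\subset H$, and for every non-empty proper $I\subset\{1,\dots,n\}$ precisely one of $P_I,P^I$ is contained in $H$. Then $\mathcal{C}(n,2)_2$ is decomposed into three subsets: - $\mathcal{A}$ is the set of all elements of $\mathcal{C}(n,2)_2$ containing $Q$; - $\mathcal{B}$ is the set of all elements of $\mathcal{C}(n,2)_2$ contained in $H$; - $\mathcal{C}=\mathcal{C}(n,2)_2\setminus(\mathcal{A}\cup\mathcal{B})$. For $X\in\mathcal{C}$, the intersection $X\cap H$ is $1$-dimensional; if $P_I,P_J$ are the two $1$-dimensional subspaces of $X$ not contained in $H$, then $X^c$ denotes the $2$-dimensional subspace $P^I+P^J$. -}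

module Defs where

open import Level using (Level; 0ℓ; _⊔_) renaming (suc to lsuc)
open import Algebra.Bundles using (AbelianGroup)
import Algebra.Properties.AbelianGroup as AbelianGroupProperties
import Algebra.Properties.CommutativeSemigroup as CommutativeSemigroupProperties
open import Data.Bool using (Bool; true; false; not; _xor_; _∧_)
import Data.Bool.Properties as Bool
open import Data.Fin using (Fin; zero; suc; inject≤)
open import Data.Fin.Subset using (Subset; Nonempty; ⁅_⁆; ∁; ⊤)
open import Data.Fin.Subset.Properties using (anySubset?)
open import Data.Nat using (ℕ; zero; suc; _∸_; _≤_)
open import Data.Nat.Properties using (m∸n≤m)
open import Data.Product using (Σ; ∃; ∃₂; _×_; _,_; proj₁; proj₂)
open import Data.Sum using (_⊎_; inj₁; inj₂)
open import Data.Vec using (Vec; []; _∷_; _∷ʳ_; map; zipWith; replicate; tabulate; lookup; here; there; initLast)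
import Data.Vec.Properties as Vec
open import Function using (_∘_; id; _on_)
open import Function.Bundles using (Func; Injection; Inverse; _⇔_)
open import Relation.Binary using (Rel; Setoid; Symmetric; Irreflexive; _Respects₂_)
import Relation.Binary.Construct.On as On
open import Relation.Binary.PropositionalEquality
  using (_≡_; _≢_; refl; sym; trans; cong; cong₂; subst; isEquivalence; module ≡-Reasoning)
open import Relation.Nullary using (¬_; Dec; yes; no; contradiction)
open import Relation.Nullary.Decidable
  using (map′; ¬?; _×-dec_; _⊎-dec_; decidable-stable; toWitnessFalse)
open import Relation.Unary using (Pred; Decidable; _⊆_; _≐_)
open import Relation.Unary.Properties using (≐-refl; ≐-sym; ≐-trans)

private
  variable
    c ℓ r p : Level
    k m n : ℕ

record Graph (c ℓ r : Level) : Set (lsuc (c ⊔ ℓ ⊔ r)) where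
  field
    vertices : Setoid c ℓ
  open Setoid vertices public using (_≈_) renaming (Carrier to Vertex)
  field
    Adjacent        : Rel Vertex r
    adjacent-resp   : Adjacent Respects₂ _≈_
    adjacent-sym    : Symmetric Adjacent
    adjacent-irrefl : Irreflexive _≈_ Adjacent

induced : (G : Graph c ℓ r) → Pred (Graph.Vertex G) p → Graph (c ⊔ p) ℓ r
induced G P = record
  { vertices        = On.setoid {B = Σ Vertex P} vertices proj₁
  ; Adjacent        = Adjacent on proj₁
  ; adjacent-resp   = proj₁ adjacent-resp , proj₂ adjacent-resp
  ; adjacent-sym    = adjacent-sym
  ; adjacent-irrefl = adjacent-irrefl
  }
  where open Graph G

record Automorphism (G : Graph c ℓ r) : Set (c ⊔ ℓ ⊔ r) where
  open Graph G
  field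
    bijection : Inverse vertices vertices
  open Inverse bijection public
  field
    adjacent-⇔ : ∀ x y → Adjacent x y ⇔ Adjacent (to x) (to y)

-- An isomorphism of G to a subgraph of G′ which need not be induced:
-- G′ may have further edges between vertices in the image.
record SubgraphIsomorphism {c₁ ℓ₁ r₁ c₂ ℓ₂ r₂}
         (G : Graph c₁ ℓ₁ r₁) (G′ : Graph c₂ ℓ₂ r₂)
         : Set (c₁ ⊔ ℓ₁ ⊔ r₁ ⊔ c₂ ⊔ ℓ₂ ⊔ r₂) where
  private
    module G  = Graph G
    module G′ = Graph G′
  field
    injection : Injection G.vertices G′.vertices
  open Injection injection public using (to; cong; injective)
  field
    adjacent-⇒ : ∀ {x y} → G.Adjacent x y → G′.Adjacent (to x) (to y)

-- 𝔽₂ is Bool with _xor_ as addition and _∧_ as multiplication.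
V : ℕ → Set
V n = Vec Bool n

infixl 6 _+_
infixr 7 _·_

0ᵛ : V n
0ᵛ = replicate _ false

_+_ : V n → V n → V n
_+_ = zipWith _xor_

_·_ : Bool → V n → V n
a · v = map (a ∧_) v

+-abelianGroup : ℕ → AbelianGroup 0ℓ 0ℓ
+-abelianGroup n = record
  { Carrier = V n
  ; _≈_ = _≡_
  ; _∙_ = _+_
  ; ε   = 0ᵛ
  ; _⁻¹ = id
  ; isAbelianGroup = record
    { isGroup = record
      { isMonoid = record
        { isSemigroup = record
          { isMagma = record
            { isEquivalence = isEquivalence
            ; ∙-cong = cong₂ _+_ }
          ; assoc = Vec.zipWith-assoc Bool.xor-assoc }
        ; identity = Vec.zipWith-identityˡ Bool.xor-identityˡ
                   , Vec.zipWith-identityʳ Bool.xor-identityʳ }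
      ; inverse = self , self
      ; ⁻¹-cong = id }
    ; comm = Vec.zipWith-comm Bool.xor-comm }
  }
  where
  self : ∀ {n} (v : V n) → v + v ≡ 0ᵛ
  self []      = refl
  self (a ∷ v) = cong₂ _∷_ (Bool.xor-same a) (self v)

private
  module + {n : ℕ} where
    open AbelianGroup (+-abelianGroup n) public
      using (assoc; comm; identityˡ; identityʳ; inverseˡ; inverseʳ)
    open CommutativeSemigroupProperties
      (AbelianGroup.commutativeSemigroup (+-abelianGroup n)) public
      using (interchange)

·-distribˡ : ∀ a (u v : V n) → a · (u + v) ≡ a · u + a · v
·-distribˡ a []      []      = refl
·-distribˡ a (x ∷ u) (y ∷ v) =
  cong₂ _∷_ (Bool.∧-distribˡ-xor a x y) (·-distribˡ a u v)

·-distribʳ : ∀ a b (v : V n) → (a xor b) · v ≡ a · v + b · v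
·-distribʳ a b []      = refl
·-distribʳ a b (x ∷ v) = cong₂ _∷_ (Bool.∧-distribʳ-xor x a b) (·-distribʳ a b v)

·-assoc : ∀ a b (v : V n) → (a ∧ b) · v ≡ a · b · v
·-assoc a b []      = refl
·-assoc a b (x ∷ v) = cong₂ _∷_ (Bool.∧-assoc a b x) (·-assoc a b v)

·-zeroˡ : ∀ (v : V n) → false · v ≡ 0ᵛ
·-zeroˡ v = Vec.map-const v false

·-zeroʳ : ∀ n a → a · 0ᵛ {n} ≡ 0ᵛ
·-zeroʳ zero    a = refl
·-zeroʳ (suc n) a = cong₂ _∷_ (Bool.∧-zeroʳ a) (·-zeroʳ n a)

·-identityˡ : ∀ (v : V n) → true · v ≡ v
·-identityˡ = Vec.map-id

combination : Vec Bool k → Vec (V n) k → V n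
combination []       []       = 0ᵛ
combination (a ∷ as) (v ∷ vs) = a · v + combination as vs

combination-0 : (vs : Vec (V n) k) → combination 0ᵛ vs ≡ 0ᵛ
combination-0 []       = refl
combination-0 (v ∷ vs) =
  trans (cong₂ _+_ (·-zeroˡ v) (combination-0 vs)) (+.identityˡ _)

combination-+ : ∀ as bs (vs : Vec (V n) k) →
                combination (as + bs) vs ≡ combination as vs + combination bs vs
combination-+ []       []       []       = sym (+.identityˡ _)
combination-+ (a ∷ as) (b ∷ bs) (v ∷ vs) = trans
  (cong₂ _+_ (·-distribʳ a b v) (combination-+ as bs vs))
  (+.interchange (a · v) (b · v) (combination as vs) (combination bs vs))

combination-· : ∀ a as (vs : Vec (V n) k) →
                combination (a · as) vs ≡ a · combination as vs
combination-· a []       []       = sym (·-zeroʳ _ a)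
combination-· a (b ∷ as) (v ∷ vs) = trans
  (cong₂ _+_ (·-assoc a b v) (combination-· a as vs))
  (sym (·-distribˡ a (b · v) (combination as vs)))

LinearlyIndependent : Vec (V n) k → Set
LinearlyIndependent vs = ∀ as → combination as vs ≡ 0ᵛ → as ≡ 0ᵛ

record Subspace (n : ℕ) : Set₁ where
  field
    Member   : Pred (V n) 0ℓ
    0-closed : Member 0ᵛ
    +-closed : ∀ {u v} → Member u → Member v → Member (u + v)
    ·-closed : ∀ a {v} → Member v → Member (a · v)

open Subspace public

infix 4 _∈_ _⊑_ _≈ₛ_
infixl 6 _+ₛ_
infixl 7 _∩_

_∈_ : V n → Subspace n → Set
v ∈ X = Member X v

_⊑_ : Subspace n → Subspace n → Set
X ⊑ Y = Member X ⊆ Member Y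

_≈ₛ_ : Subspace n → Subspace n → Set
X ≈ₛ Y = Member X ≐ Member Y

subspaces : ℕ → Setoid (lsuc 0ℓ) 0ℓ
subspaces n = record
  { Carrier = Subspace n
  ; _≈_ = _≈ₛ_
  ; isEquivalence = record { refl = ≐-refl ; sym = ≐-sym ; trans = ≐-trans }
  }

_∩_ : Subspace n → Subspace n → Subspace n
X ∩ Y = record
  { Member   = λ v → v ∈ X × v ∈ Y
  ; 0-closed = 0-closed X , 0-closed Y
  ; +-closed = λ (u∈X , u∈Y) (v∈X , v∈Y) → +-closed X u∈X v∈X , +-closed Y u∈Y v∈Y
  ; ·-closed = λ a (v∈X , v∈Y) → ·-closed X a v∈X , ·-closed Y a v∈Y
  }

_+ₛ_ : Subspace n → Subspace n → Subspace n
X +ₛ Y = record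
  { Member   = λ v → ∃₂ λ x y → x ∈ X × y ∈ Y × v ≡ x + y
  ; 0-closed = 0ᵛ , 0ᵛ , 0-closed X , 0-closed Y , sym (+.identityˡ 0ᵛ)
  ; +-closed = λ { (x , y , x∈X , y∈Y , refl) (x′ , y′ , x′∈X , y′∈Y , refl) →
      x + x′ , y + y′ , +-closed X x∈X x′∈X , +-closed Y y∈Y y′∈Y
      , +.interchange x y x′ y′ }
  ; ·-closed = λ { a (x , y , x∈X , y∈Y , refl) →
      a · x , a · y , ·-closed X a x∈X , ·-closed Y a y∈Y , ·-distribˡ a x y }
  }

span : Vec (V n) k → Subspace n
span vs = record
  { Member   = λ v → ∃ λ as → combination as vs ≡ v
  ; 0-closed = 0ᵛ , combination-0 vs
  ; +-closed = λ { (as , refl) (bs , refl) → as + bs , combination-+ as bs vs }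
  ; ·-closed = λ { a (as , refl) → a · as , combination-· a as vs }
  }

HasDimension : ℕ → Pred (Subspace n) 0ℓ
HasDimension k X = ∃ λ (vs : Vec _ k) → LinearlyIndependent vs × X ≈ₛ span vs

HasDimension-resp : {X Y : Subspace n} → X ≈ₛ Y → HasDimension k X → HasDimension k Y
HasDimension-resp X≈Y (vs , indep , X≈vs) = vs , indep , ≐-trans (≐-sym X≈Y) X≈vs

Γ₂ : ℕ → Graph (lsuc 0ℓ) 0ℓ 0ℓ
Γ₂ n = record
  { vertices        = On.setoid {B = Σ (Subspace n) (HasDimension 2)} (subspaces n) proj₁
  ; Adjacent        = Adj on proj₁
  ; adjacent-resp   = (λ {X Y Z} → respʳ {proj₁ X} {proj₁ Y} {proj₁ Z})
                    , (λ {X Y Z} Y≈Z a → symm {proj₁ X} {proj₁ Z}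
                        (respʳ {proj₁ X} {proj₁ Y} {proj₁ Z} Y≈Z (symm {proj₁ Y} {proj₁ X} a)))
  ; adjacent-sym    = λ {X Y} → symm {proj₁ X} {proj₁ Y}
  ; adjacent-irrefl = λ X≈Y (X≉Y , _) → X≉Y X≈Y
  }
  where
  Adj : Rel (Subspace n) 0ℓ
  Adj X Y = ¬ X ≈ₛ Y × HasDimension 1 (X ∩ Y)

  symm : ∀ {X Y} → Adj X Y → Adj Y X
  symm {X} {Y} (X≉Y , dim) = X≉Y ∘ ≐-sym ,
    HasDimension-resp {X = X ∩ Y} {Y ∩ X}
      ((λ (a , b) → b , a) , (λ (a , b) → b , a)) dim

  respʳ : ∀ {X Y Z} → Y ≈ₛ Z → Adj X Y → Adj X Z
  respʳ {X} {Y} {Z} Y≈Z (X≉Y , dim) =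
    (λ X≈Z → X≉Y (≐-trans X≈Z (≐-sym Y≈Z))) ,
    HasDimension-resp {X = X ∩ Y} {X ∩ Z}
      ((λ (a , b) → a , proj₁ Y≈Z b) , (λ (a , b) → a , proj₂ Y≈Z b)) dim

coordinateHyperplane : Fin n → Subspace n
coordinateHyperplane i = record
  { Member   = λ v → lookup v i ≡ false
  ; 0-closed = Vec.lookup-replicate i false
  ; +-closed = λ {u} {v} uᵢ≡0 vᵢ≡0 →
      trans (Vec.lookup-zipWith _xor_ i u v) (cong₂ _xor_ uᵢ≡0 vᵢ≡0)
  ; ·-closed = λ a {v} vᵢ≡0 →
      trans (Vec.lookup-map i (a ∧_) v) (trans (cong (a ∧_) vᵢ≡0) (Bool.∧-zeroʳ a))
  }

NonDegenerate : Pred (Subspace n) 0ℓ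
NonDegenerate X = ∀ i → ¬ X ⊑ coordinateHyperplane i

ΓCodes : ℕ → Graph (lsuc 0ℓ) 0ℓ 0ℓ
ΓCodes n = induced (Γ₂ n) (NonDegenerate ∘ proj₁)

Plane Code : ℕ → Set₁
Plane n = Graph.Vertex (Γ₂ n)
Code  n = Graph.Vertex (ΓCodes n)

inclusion : Code n → Plane n
inclusion = proj₁

⟦_⟧ : Code n → Subspace n
⟦ X ⟧ = proj₁ (inclusion X)

-- Subset n is Vec Bool n, so a subset I is its own characteristic
-- vector.  P I has dimension 1 when I is non-empty.
P : Subset n → Subspace n
P I = span (I ∷ [])

-- The line written P^I, that is P_{I^c}.
Pᶜ : Subset n → Subspace n
Pᶜ I = P (∁ I)

Q : Subspace n
Q = P ⊤

-- Spanned by P^1, …, P^(n-1): the last coordinate is left out.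
H : Subspace n
H {n} = span (tabulate {n = n ∸ 1} λ i → ∁ ⁅ inject≤ i (m∸n≤m n 1) ⁆)

𝒜 ℬ 𝒞 : Pred (Code n) 0ℓ
𝒜 X = Q ⊑ ⟦ X ⟧
ℬ X = ⟦ X ⟧ ⊑ H
𝒞 X = ¬ (𝒜 X ⊎ ℬ X)

-- P_I and P_J are the two lines of X that are not contained in H.
record OutsidePair (X : Subspace n) (I J : Subset n) : Set where
  field
    I-nonempty : Nonempty I
    I-proper   : I ≢ ⊤
    J-nonempty : Nonempty J
    J-proper   : J ≢ ⊤
    distinct   : I ≢ J
    I⊑X        : P I ⊑ X
    J⊑X        : P J ⊑ X
    I⋢H        : ¬ P I ⊑ H
    J⋢H        : ¬ P J ⊑ H

_≟ᵛ_ : (u v : V n) → Dec (u ≡ v)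
_≟ᵛ_ = Vec.≡-dec Bool._≟_

_∈span?_ : ∀ v (vs : Vec (V n) k) → Dec (v ∈ span vs)
v ∈span? vs = anySubset? λ as → combination as vs ≟ᵛ v

member? : {X : Subspace n} → HasDimension k X → Decidable (Member X)
member? (vs , _ , X⊆ , ⊆X) v = map′ ⊆X X⊆ (v ∈span? vs)

⊑-dec : (X Y : Subspace n) → Decidable (Member X) → Decidable (Member Y) → Dec (X ⊑ Y)
⊑-dec X Y X? Y? = map′
  (λ none {v} v∈X → decidable-stable (Y? v) λ v∉Y → none (v , v∈X , v∉Y))
  (λ X⊑Y (v , v∈X , v∉Y) → v∉Y (X⊑Y v∈X))
  (¬? (anySubset? λ v → X? v ×-dec ¬? (Y? v)))

H? : Decidable (Member (H {n}))
H? v = v ∈span? _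

𝒜⊎ℬ? : (X : Code n) → Dec (𝒜 X ⊎ ℬ X)
𝒜⊎ℬ? {n} X@((_ , dim) , _) =
  ⊑-dec Q ⟦ X ⟧ (_∈span? (⊤ ∷ [])) (member? {X = ⟦ X ⟧} dim)
  ⊎-dec ⊑-dec ⟦ X ⟧ (H {n}) (member? {X = ⟦ X ⟧} dim) H?

∈P : (I : Subset n) → I ∈ P I
∈P I = (true ∷ []) , trans (+.identityʳ _) (·-identityˡ I)

P⊑ : (X : Subspace n) {I : Subset n} → I ∈ X → P I ⊑ X
P⊑ X I∈X (a ∷ [] , refl) = +-closed X (·-closed X a I∈X) (0-closed X)

+-cancel : (u v : V n) → (u + v) + v ≡ u
+-cancel u v = trans (+.assoc u v v) (trans (cong (u +_) (+.inverseʳ v)) (+.identityʳ u))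

nonempty : {I : Subset n} → I ≢ 0ᵛ → Nonempty I
nonempty {I = []}        I≢0 = contradiction refl I≢0
nonempty {I = true  ∷ I} I≢0 = zero , here
nonempty {I = false ∷ I} I≢0 with nonempty (I≢0 ∘ cong (false ∷_))
... | i , i∈I = suc i , there i∈I

+-cancelˡ : (u v : V n) → u + (u + v) ≡ v
+-cancelˡ u v = trans (sym (+.assoc u u v)) (trans (cong (_+ v) (+.inverseʳ u)) (+.identityˡ v))

≡⇐+≡0 : {u v : V n} → u + v ≡ 0ᵛ → u ≡ v
≡⇐+≡0 {u = u} {v} eq =
  trans (sym (+-cancel u v)) (trans (cong (_+ v) eq) (+.identityˡ v))

outsidePair : (X : Code n) → 𝒞 X → ∃₂ (OutsidePair ⟦ X ⟧)
outsidePair {n} X@((_ , (x ∷ y ∷ [] , indep , X⊆ , ⊆X)) , _) X∈𝒞 =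
  choose (H? x) (H? y)
  where
  W = ⟦ X ⟧

  x∈ : x ∈ W
  x∈ = ⊆X ((true ∷ false ∷ []) ,
    trans (cong₂ _+_ (·-identityˡ x) (trans (+.identityʳ _) (·-zeroˡ y))) (+.identityʳ x))

  y∈ : y ∈ W
  y∈ = ⊆X ((false ∷ true ∷ []) ,
    trans (cong₂ _+_ (·-zeroˡ x) (trans (+.identityʳ _) (·-identityˡ y))) (+.identityˡ y))

  x≢y : x ≢ y
  x≢y refl with indep (true ∷ true ∷ [])
    (trans (cong ((true · x) +_) (+.identityʳ _)) (+.inverseʳ _))
  ... | ()

  x≢0 : x ≢ 0ᵛ
  x≢0 x≡0 with indep (true ∷ false ∷ [])
    (trans (cong₂ _+_ (trans (·-identityˡ x) x≡0)
                      (trans (+.identityʳ _) (·-zeroˡ y)))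
           (+.identityˡ _))
  ... | ()

  y≢0 : y ≢ 0ᵛ
  y≢0 y≡0 with indep (false ∷ true ∷ [])
    (trans (cong₂ _+_ (·-zeroˡ x)
                      (trans (+.identityʳ _) (trans (·-identityˡ y) y≡0)))
           (+.identityˡ _))
  ... | ()

  proper : ∀ {I} → I ∈ W → I ≢ ⊤
  proper I∈ refl = X∈𝒞 (inj₁ (λ {v} → P⊑ W I∈ {v}))

  pair : ∀ {I J} → I ∈ W → J ∈ W → ¬ I ∈ H → ¬ J ∈ H → I ≢ J → OutsidePair W I J
  pair {I} {J} I∈ J∈ I∉H J∉H I≢J = record
    { I-nonempty = nonempty λ { refl → I∉H (0-closed (H {n})) }
    ; I-proper   = proper I∈
    ; J-nonempty = nonempty λ { refl → J∉H (0-closed (H {n})) }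
    ; J-proper   = proper J∈
    ; distinct   = I≢J
    ; I⊑X        = P⊑ W I∈
    ; J⊑X        = P⊑ W J∈
    ; I⋢H        = λ P⊑H → I∉H (P⊑H (∈P I))
    ; J⋢H        = λ P⊑H → J∉H (P⊑H (∈P J))
    }

  choose : Dec (x ∈ H) → Dec (y ∈ H) → ∃₂ (OutsidePair W)
  choose (yes x∈H) (yes y∈H) = contradiction (inj₂ λ {v} v∈ → W⊑H (X⊆ v∈)) X∈𝒞
    where
    W⊑H : ∀ {v} → v ∈ span (x ∷ y ∷ []) → v ∈ H
    W⊑H (a ∷ b ∷ [] , refl) = +-closed (H {n}) (·-closed (H {n}) a x∈H)
      (+-closed (H {n}) (·-closed (H {n}) b y∈H) (0-closed (H {n})))
  choose (no x∉H) (no y∉H) = x , y , pair x∈ y∈ x∉H y∉H x≢y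
  choose (no x∉H) (yes y∈H) = x , x + y , pair x∈ (+-closed W x∈ y∈) x∉H
    (λ x+y∈H → x∉H (subst (_∈ H) (+-cancel x y) (+-closed (H {n}) x+y∈H y∈H)))
    (λ x≡x+y → y≢0 (trans (sym (+-cancelˡ x y))
                          (trans (cong (x +_) (sym x≡x+y)) (+.inverseʳ x))))
  choose (yes x∈H) (no y∉H) = y , x + y , pair y∈ (+-closed W x∈ y∈) y∉H
    (λ x+y∈H → y∉H (subst (_∈ H) (+-cancelˡ x y) (+-closed (H {n}) x∈H x+y∈H)))
    (λ y≡x+y → x≢0 (trans (sym (+-cancel x y))
                          (trans (cong (_+ y) (sym y≡x+y)) (+.inverseʳ y))))

∁≡⊤+ : (I : Subset n) → ∁ I ≡ ⊤ + I
∁≡⊤+ []      = refl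
∁≡⊤+ (a ∷ I) = cong₂ _∷_ (sym (Bool.true-xor a)) (∁≡⊤+ I)

⊤+-involutive : (v : V n) → ⊤ + (⊤ + v) ≡ v
⊤+-involutive = +-cancelˡ ⊤

∁-injective : {I J : Subset n} → ∁ I ≡ ∁ J → I ≡ J
∁-injective {I = I} {J} eq = begin
  I            ≡⟨ ⊤+-involutive I ⟨
  ⊤ + (⊤ + I)  ≡⟨ cong (⊤ +_) (trans (sym (∁≡⊤+ I)) (trans eq (∁≡⊤+ J))) ⟩
  ⊤ + (⊤ + J)  ≡⟨ ⊤+-involutive J ⟩
  J            ∎
  where open ≡-Reasoning

independent₂ : {u v : V n} → u ≢ 0ᵛ → v ≢ 0ᵛ → u ≢ v → LinearlyIndependent (u ∷ v ∷ [])
independent₂ _ _ _ (false ∷ false ∷ []) _ = refl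
independent₂ {u = u} {v} u≢0 _ _ (true ∷ false ∷ []) eq = contradiction
  (trans (sym (trans (cong₂ _+_ (·-identityˡ u) (trans (+.identityʳ _) (·-zeroˡ v)))
                     (+.identityʳ u))) eq) u≢0
independent₂ {u = u} {v} _ v≢0 _ (false ∷ true ∷ []) eq = contradiction
  (trans (sym (trans (cong₂ _+_ (·-zeroˡ u) (trans (+.identityʳ _) (·-identityˡ v)))
                     (+.identityˡ v))) eq) v≢0
independent₂ {u = u} {v} _ _ u≢v (true ∷ true ∷ []) eq = contradiction
  (≡⇐+≡0 (trans (sym (cong₂ _+_ (·-identityˡ u) (trans (+.identityʳ _) (·-identityˡ v))))
                eq)) u≢v

P+P≈span : (u v : V n) → P u +ₛ P v ≈ₛ span (u ∷ v ∷ [])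
P+P≈span u v =
  (λ { (_ , _ , (a ∷ [] , refl) , (b ∷ [] , refl) , refl) →
       a ∷ b ∷ [] , cong (_+ (b · v + 0ᵛ)) (sym (+.identityʳ (a · u))) }) ,
  (λ { (a ∷ b ∷ [] , refl) →
       _ , _ , (a ∷ [] , refl) , (b ∷ [] , refl)
       , cong (_+ (b · v + 0ᵛ)) (sym (+.identityʳ (a · u))) })

complement-dim : {X : Subspace n} {I J : Subset n} → OutsidePair X I J →
                 HasDimension 2 (Pᶜ I +ₛ Pᶜ J)
complement-dim {I = I} {J} o =
  ∁ I ∷ ∁ J ∷ [] ,
  independent₂ (∁≢0 I-proper) (∁≢0 J-proper) (distinct ∘ ∁-injective) ,
  P+P≈span (∁ I) (∁ J)
  where
  open OutsidePair o
  ∁≢0 : ∀ {K} → K ≢ ⊤ → ∁ K ≢ 0ᵛ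
  ∁≢0 {K} K≢⊤ ∁K≡0 = K≢⊤ (sym (≡⇐+≡0 (trans (sym (∁≡⊤+ K)) ∁K≡0)))

-- X^c = P^I + P^J; complement-unique below shows that the choice of the
-- pair I, J does not matter.
complement : (X : Code n) → 𝒞 X → Plane n
complement X X∈𝒞 with outsidePair X X∈𝒞
... | I , J , o = Pᶜ I +ₛ Pᶜ J , complement-dim o

-- In 𝔽₂², the span of two distinct non-zero vectors is everything.
private
  among : V n → V n → V n → Set
  among u v w = w ≡ 0ᵛ ⊎ w ≡ u ⊎ w ≡ v ⊎ w ≡ u + v

  among? : (u v w : V n) → Dec (among u v w)
  among? u v w = (w ≟ᵛ 0ᵛ) ⊎-dec (w ≟ᵛ u) ⊎-dec (w ≟ᵛ v) ⊎-dec (w ≟ᵛ (u + v))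

  Exception : V 2 → V 2 → V 2 → Set
  Exception u v w = (u ≢ 0ᵛ × v ≢ 0ᵛ × u ≢ v) × ¬ among u v w

  exception? : Dec (∃ λ u → ∃ λ v → ∃ λ w → Exception u v w)
  exception? = anySubset? λ u → anySubset? λ v → anySubset? λ w →
    (¬? (u ≟ᵛ 0ᵛ) ×-dec ¬? (v ≟ᵛ 0ᵛ) ×-dec ¬? (u ≟ᵛ v)) ×-dec ¬? (among? u v w)

among-𝔽₂² : {u v : V 2} → u ≢ 0ᵛ → v ≢ 0ᵛ → u ≢ v → ∀ w → among u v w
among-𝔽₂² {u} {v} u≢0 v≢0 u≢v w = decidable-stable (among? u v w) λ ¬a →
  toWitnessFalse {a? = exception?} _ (u , v , w , (u≢0 , v≢0 , u≢v) , ¬a)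

among-plane : {X : Subspace n} → HasDimension 2 X → ∀ {u v w} → u ∈ X → v ∈ X → w ∈ X →
              u ≢ 0ᵛ → v ≢ 0ᵛ → u ≢ v → among u v w
among-plane (bs , _ , X⊆ , _) u∈ v∈ w∈ u≢0 v≢0 u≢v with X⊆ u∈ | X⊆ v∈ | X⊆ w∈
... | a , refl | b , refl | c , refl
  with among-𝔽₂² {a} {b}
         (λ { refl → u≢0 (combination-0 bs) })
         (λ { refl → v≢0 (combination-0 bs) })
         (λ { refl → u≢v refl }) c
... | inj₁ refl               = inj₁ (combination-0 bs)
... | inj₂ (inj₁ refl)        = inj₂ (inj₁ refl)
... | inj₂ (inj₂ (inj₁ refl)) = inj₂ (inj₂ (inj₁ refl))
... | inj₂ (inj₂ (inj₂ refl)) = inj₂ (inj₂ (inj₂ (combination-+ a b bs)))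

-- V = H + Q, so that the sum of two vectors outside H is in H.

comap-false∷ : Subspace (suc n) → Subspace n
comap-false∷ X = record
  { Member   = λ v → false ∷ v ∈ X
  ; 0-closed = 0-closed X
  ; +-closed = +-closed X
  ; ·-closed = λ a {v} v∈ →
      subst (λ b → b ∷ a · v ∈ X) (Bool.∧-zeroʳ a) (·-closed X a v∈)
  }

init⊑ : ∀ {m} .(m≤ : m ≤ suc m) (X : Subspace (suc m)) →
        (∀ (i : Fin m) → ⁅ inject≤ i m≤ ⁆ ∈ X) → ∀ as → as ∷ʳ false ∈ X
init⊑ m≤ X e∈ []       = 0-closed X
init⊑ {suc m} m≤ X e∈ (a ∷ as) = subst (_∈ X)
  (cong₂ _∷_ (trans (Bool.xor-identityʳ _) (Bool.∧-identityʳ a))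
             (trans (cong (_+ (as ∷ʳ false)) (·-zeroʳ _ a)) (+.identityˡ _)))
  (+-closed X (·-closed X a (e∈ zero))
    (init⊑ (m∸n≤m (suc m) 1) (comap-false∷ X) (λ i → e∈ (suc i)) as))

∈span-tabulate : ∀ {k} (f : Fin k → V n) i → f i ∈ span (tabulate f)
∈span-tabulate {k = suc k} f zero = true ∷ 0ᵛ ,
  trans (cong₂ _+_ (·-identityˡ (f zero)) (combination-0 (tabulate (f ∘ suc))))
        (+.identityʳ (f zero))
∈span-tabulate {k = suc k} f (suc i) with ∈span-tabulate (f ∘ suc) i
... | as , eq = false ∷ as ,
  trans (cong₂ _+_ (·-zeroˡ (f zero)) eq) (+.identityˡ _)

H+Q : (v : V n) → v ∈ H +ₛ Q
H+Q {zero}  [] = 0-closed (H +ₛ Q {0})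
H+Q {suc m} v  = go (initLast v)
  where
  init∈ : ∀ as → as ∷ʳ false ∈ H +ₛ Q
  init∈ = init⊑ (m∸n≤m (suc m) 1) (H +ₛ Q) λ i → _ , ⊤ , ∈span-tabulate _ i , ∈P ⊤ ,
    sym (trans (cong (_+ ⊤) (∁≡⊤+ _)) (trans (+.comm _ _) (⊤+-involutive _)))

  ⊤∈ : ⊤ ∈ H +ₛ Q
  ⊤∈ = 0ᵛ , ⊤ , 0-closed (H {suc m}) , ∈P ⊤ , sym (+.identityˡ ⊤)

  ∷ʳ-true : ∀ {m} (as : V m) → ⊤ + (∁ as ∷ʳ false) ≡ as ∷ʳ true
  ∷ʳ-true []       = refl
  ∷ʳ-true (a ∷ as) = cong₂ _∷_ (trans (Bool.true-xor (not a)) (Bool.not-involutive a)) (∷ʳ-true as)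

  go : ∃₂ (λ as a → v ≡ as ∷ʳ a) → v ∈ H +ₛ Q
  go (as , false , refl) = init∈ as
  go (as , true  , refl) =
    subst (_∈ H +ₛ Q) (∷ʳ-true as) (+-closed (H +ₛ Q) ⊤∈ (init∈ (∁ as)))

∉H⇒∁∈H : {v : V n} → ¬ v ∈ H → ∁ v ∈ H
∉H⇒∁∈H {v = v} v∉H with H+Q v
... | x , _ , x∈H , (false ∷ [] , refl) , refl = contradiction
  (subst (_∈ H) (sym (trans (cong (x +_) (trans (+.identityʳ _) (·-zeroˡ ⊤))) (+.identityʳ x))) x∈H)
  v∉H
... | x , _ , x∈H , (true ∷ [] , refl) , refl = subst (_∈ H)
  (sym (trans (∁≡⊤+ _)
    (trans (cong (⊤ +_) (trans (cong (x +_) (trans (+.identityʳ _) (·-identityˡ ⊤))) (+.comm x ⊤)))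
           (⊤+-involutive x))))
  x∈H

∉H+∉H : {u v : V n} → ¬ u ∈ H → ¬ v ∈ H → u + v ∈ H
∉H+∉H {n} {u} {v} u∉H v∉H = subst (_∈ H)
  (trans (cong₂ _+_ (∁≡⊤+ u) (∁≡⊤+ v))
    (trans (+.interchange ⊤ u ⊤ v)
      (trans (cong (_+ (u + v)) (+.inverseʳ ⊤)) (+.identityˡ _))))
  (+-closed (H {n}) (∉H⇒∁∈H u∉H) (∉H⇒∁∈H v∉H))

+ₛ-least : (X Y Z : Subspace n) → X ⊑ Z → Y ⊑ Z → X +ₛ Y ⊑ Z
+ₛ-least _ _ Z X⊑Z Y⊑Z (_ , _ , x∈X , y∈Y , refl) = +-closed Z (X⊑Z x∈X) (Y⊑Z y∈Y)

outsidePair-⊑ : {X : Subspace n} → HasDimension 2 X →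
                ∀ {I J I′ J′} → OutsidePair X I J → OutsidePair X I′ J′ →
                Pᶜ I′ +ₛ Pᶜ J′ ⊑ Pᶜ I +ₛ Pᶜ J
outsidePair-⊑ {n} {X} dim {I} {J} {I′} {J′} o o′ =
  +ₛ-least (Pᶜ I′) (Pᶜ J′) Z (P⊑ Z (∁∈Z I⊑X′ I⋢H′)) (P⊑ Z (∁∈Z J⊑X′ J⋢H′))
  where
  open OutsidePair o
  open OutsidePair o′ using ()
    renaming (I⊑X to I⊑X′; J⊑X to J⊑X′; I⋢H to I⋢H′; J⋢H to J⋢H′)

  Z = Pᶜ I +ₛ Pᶜ J

  ∉H : ∀ {K} → ¬ P K ⊑ H → ¬ K ∈ H
  ∉H K⋢H K∈H = K⋢H (P⊑ (H {n}) K∈H)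

  ∁∈Z : ∀ {K} → P K ⊑ X → ¬ P K ⊑ H → ∁ K ∈ Z
  ∁∈Z {K} K⊑X K⋢H with among-plane {X = X} dim (I⊑X (∈P I)) (J⊑X (∈P J)) (K⊑X (∈P K))
                          (λ { refl → ∉H I⋢H (0-closed (H {n})) })
                          (λ { refl → ∉H J⋢H (0-closed (H {n})) }) distinct
  ... | inj₁ refl               = contradiction (0-closed (H {n})) (∉H K⋢H)
  ... | inj₂ (inj₁ refl)        = ∁ I , 0ᵛ , ∈P (∁ I) , 0-closed (Pᶜ J) , sym (+.identityʳ _)
  ... | inj₂ (inj₂ (inj₁ refl)) = 0ᵛ , ∁ J , 0-closed (Pᶜ I) , ∈P (∁ J) , sym (+.identityˡ _)
  ... | inj₂ (inj₂ (inj₂ refl)) = contradiction (∉H+∉H (∉H I⋢H) (∉H J⋢H)) (∉H K⋢H)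

complement-unique : (X : Code n) (X∈𝒞 : 𝒞 X) → ∀ {I J} → OutsidePair ⟦ X ⟧ I J →
                    proj₁ (complement X X∈𝒞) ≈ₛ Pᶜ I +ₛ Pᶜ J
complement-unique X@((_ , dim) , _) X∈𝒞 o =
  outsidePair-⊑ dim o o′ , outsidePair-⊑ dim o′ o
  where o′ = proj₂ (proj₂ (outsidePair X X∈𝒞))

OutsidePair-resp : {X Y : Subspace n} → X ≈ₛ Y → ∀ {I J} → OutsidePair X I J → OutsidePair Y I J
OutsidePair-resp (X⊑Y , _) o = record
  { OutsidePair o ; I⊑X = X⊑Y ∘ OutsidePair.I⊑X o ; J⊑X = X⊑Y ∘ OutsidePair.J⊑X o }

image : (X : Code n) → Dec (𝒜 X ⊎ ℬ X) → Plane n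
image X (yes _)   = inclusion X
image X (no  X∈𝒞) = complement X X∈𝒞

𝒜⊎ℬ-resp : (X Y : Code n) → ⟦ X ⟧ ≈ₛ ⟦ Y ⟧ → 𝒜 X ⊎ ℬ X → 𝒜 Y ⊎ ℬ Y
𝒜⊎ℬ-resp _ _ (X⊑Y , _) (inj₁ Q⊑X) = inj₁ (X⊑Y ∘ Q⊑X)
𝒜⊎ℬ-resp _ _ (_ , Y⊑X) (inj₂ X⊑H) = inj₂ (X⊑H ∘ Y⊑X)

image-cong : (X Y : Code n) → ∀ d e → ⟦ X ⟧ ≈ₛ ⟦ Y ⟧ →
             proj₁ (image X d) ≈ₛ proj₁ (image Y e)
image-cong X Y (yes _)   (yes _)   X≈Y = X≈Y
image-cong X Y (yes X∈)  (no  Y∈𝒞) X≈Y = contradiction (𝒜⊎ℬ-resp X Y X≈Y X∈) Y∈𝒞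
image-cong X Y (no  X∈𝒞) (yes Y∈)  X≈Y =
  contradiction (𝒜⊎ℬ-resp Y X (≐-sym X≈Y) Y∈) X∈𝒞
image-cong X Y (no  X∈𝒞) (no  Y∈𝒞) X≈Y = complement-unique X X∈𝒞
  (OutsidePair-resp (≐-sym X≈Y) (proj₂ (proj₂ (outsidePair Y Y∈𝒞))))

h : Func (Graph.vertices (ΓCodes n)) (Graph.vertices (Γ₂ n))
h = record
  { to   = λ X → image X (𝒜⊎ℬ? X)
  ; cong = λ {X Y} → image-cong X Y (𝒜⊎ℬ? X) (𝒜⊎ℬ? Y)
  }

Extends : Automorphism (Γ₂ n) → SubgraphIsomorphism (ΓCodes n) (Γ₂ n) → Set₁
Extends {n} g f = ∀ X → SubgraphIsomorphism.to f X ≈ Automorphism.to g (inclusion X)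
  where open Graph (Γ₂ n) using (_≈_)

{-# OPTIONS --safe #-}
module Submission where

-- The non-zero vectors of a code are the complements of the parts of a partition
-- of the coordinates into three parts, at most one of them empty, and two codes
-- are adjacent iff their partitions share a part.
--
-- The codes through ⊤ are pairwise adjacent, so their images either share a vector
-- q or lie in a three-dimensional subspace.  The latter has only seven planes, so
-- then n = 4 and composing f with the duality of 𝔽₂⁴ leads back to the former.
-- By counting, the image of a code X not through ⊤ avoids q; it therefore meets
-- the image of the code through ⊤ and p, for p in X, in one point ψ p, and
-- adjacency makes ψ p independent of X.  Thus ψ sums to zero on the vectors of
-- every such X, which forces ψ to be the restriction of a linear map F with
-- F ⊤ ∈ {0, q}.  If F ⊤ = q, then F is invertible and extends f.  If F ⊤ = 0 and χ
-- is the functional with kernel H, then G v = F v + χ v · q is invertible, and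
-- f = G h because h adds χ v · ⊤ to the vectors of a code not through ⊤.

open import Defs
open import Algebra.Bundles using (AbelianGroup; CommutativeRing)
import Algebra.Properties.CommutativeSemigroup as CommutativeSemigroupProperties
open import Data.Bool using (Bool; true; false; not; _xor_; _∧_)
import Data.Bool.Properties as Bool
open import Data.Empty using (⊥)
open import Data.Fin using (Fin; zero; suc)
import Data.Fin as Fin
open import Data.Fin.Properties using (2↔Bool; *↔×; any?; injective⇒≤)
open import Data.Fin.Subset using (⁅_⁆; ∁; ⊤; ∣_∣)
open import Data.Fin.Subset.Properties using (anySubset?; x∈⁅x⁆; x∈⁅y⁆⇒x≡y; ∣⁅x⁆∣≡1; ∣⊤∣≡n)
open import Data.Nat using (ℕ; _≤_; zero; suc; s≤s; z≤n; _^_)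
import Data.Nat as ℕ
import Data.Nat.Properties as ℕ
open import Data.Product using (∃; ∃₂; _×_; _,_; proj₁; proj₂; uncurry)
open import Data.Product.Function.NonDependent.Propositional using (_×-↔_)
open import Data.Sum using (_⊎_; inj₁; inj₂; [_,_]′)
open import Data.Vec using (Vec; []; _∷_; lookup; map; tabulate; tail)
import Data.Vec.Properties as Vec
open import Function using (_∘_; case_of_; flip; id)
open import Function.Bundles using (Func; Injection; Inverse; _↔_; mk↔ₛ′; mk⇔)
open import Function.Construct.Composition using (inverse; equivalence)
open import Function.Definitions using (Injective)
open import Function.Properties.Inverse using (↔-sym; ↔-trans; ↔⇒↣)
open import Relation.Binary using (Setoid)
open import Relation.Binary.PropositionalEquality
  using (_≡_; _≢_; refl; sym; trans; cong; cong₂; subst; module ≡-Reasoning)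
open import Relation.Nullary using (¬_; Dec; does; yes; no; contradiction)
open import Relation.Nullary.Decidable
  using (map′; ¬?; _×-dec_; _⊎-dec_; dec-true; dec-false; decidable-stable; toWitnessFalse)

private
  variable
    k l m n : ℕ
    p q r u v w x y : V n

-- Counting and cancellation over 𝔽₂

module + {n : ℕ} where
  open AbelianGroup (+-abelianGroup n) public
    using (assoc; comm; identityˡ; identityʳ; inverseʳ)
  open CommutativeSemigroupProperties
    (AbelianGroup.commutativeSemigroup (+-abelianGroup n)) public
    using (interchange)

V↔Fin : ∀ n → V n ↔ Fin (2 ^ n)
V↔Fin zero    = mk↔ₛ′ (λ _ → zero) (λ _ → []) (λ { zero → refl }) (λ { [] → refl })
V↔Fin (suc n) = ↔-trans uncons (↔-trans (↔-sym 2↔Bool ×-↔ V↔Fin n) (↔-sym *↔×))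
  where
  uncons : V (suc n) ↔ (Bool × V n)
  uncons = mk↔ₛ′ (λ { (a ∷ v) → a , v }) (λ (a , v) → a ∷ v) (λ _ → refl) (λ { (a ∷ v) → refl })

↔-injective : {A B : Set} (i : A ↔ B) → Injective _≡_ _≡_ (Inverse.to i)
↔-injective i = Injection.injective (↔⇒↣ i)

injective⇒≤-dim : {g : V k → V l} → Injective _≡_ _≡_ g → k ≤ l
injective⇒≤-dim {k} {l} {g} g-inj =
  ℕ.≮⇒≥ λ l<k → ℕ.<⇒≱ (ℕ.^-monoʳ-< 2 (ℕ.n<1+n 1) l<k) (injective⇒≤
    {f = Inverse.to (V↔Fin l) ∘ g ∘ Inverse.from (V↔Fin k)}
    (↔-injective (↔-sym (V↔Fin k)) ∘ g-inj ∘ ↔-injective (V↔Fin l)))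

-- A missed value `v` could be put in front of the `2 ^ n` values of `g`, which would inject
-- `2 ^ n + 1` indices into `2 ^ n`.
injective⇒surjective : {g : V n → V n} → Injective _≡_ _≡_ g → ∀ v → ∃ λ u → g u ≡ v
injective⇒surjective {n} {g} g-inj v with anySubset? (λ u → g u ≟ᵛ v)
... | yes hit = hit
... | no miss = contradiction (injective⇒≤ {f = g⁺} g⁺-inj) ℕ.1+n≰n
  where
  open Inverse (V↔Fin n) using (to; from)
  g⁺ : Fin (suc (2 ^ n)) → Fin (2 ^ n)
  g⁺ zero    = to v
  g⁺ (suc i) = to (g (from i))
  g⁺-inj : Injective _≡_ _≡_ g⁺
  g⁺-inj {zero}  {zero}  _  = refl
  g⁺-inj {zero}  {suc j} eq = contradiction (from j , sym (↔-injective (V↔Fin n) eq)) miss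
  g⁺-inj {suc i} {zero}  eq = contradiction (from i , ↔-injective (V↔Fin n) eq) miss
  g⁺-inj {suc i} {suc j} eq =
    cong suc (↔-injective (↔-sym (V↔Fin n)) (g-inj (↔-injective (V↔Fin n) eq)))

+-same : (v : V n) → v + v ≡ 0ᵛ
+-same = +.inverseʳ

x+y≡z⇒y≡x+z : u + v ≡ w → v ≡ u + w
x+y≡z⇒y≡x+z {u = u} {v} refl = sym (+-cancelˡ u v)

≡0⇐≡+ : u ≡ u + v → v ≡ 0ᵛ
≡0⇐≡+ {u = u} {v} eq = trans (x+y≡z⇒y≡x+z {u = u} (sym eq)) (+-same u)

+-injectiveʳ : (u : V n) → u + v ≡ u + w → v ≡ w
+-injectiveʳ {v = v} {w} u eq = trans (sym (+-cancelˡ u v)) (trans (cong (u +_) eq) (+-cancelˡ u w))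

≢⇒+≢0 : u ≢ v → u + v ≢ 0ᵛ
≢⇒+≢0 u≢v eq = u≢v (≡⇐+≡0 eq)

-- Planes

module _ {n : ℕ} where
  open Graph (Γ₂ n) public using (_≈_; Adjacent)

infix 4 _∈ᵖ_
_∈ᵖ_ : V n → Plane n → Set
v ∈ᵖ X = v ∈ proj₁ X

abstract
  ∈ᵖ? : (X : Plane n) (v : V n) → Dec (v ∈ᵖ X)
  ∈ᵖ? (X , dim) = member? {X = X} dim

_≈?_ : (X Y : Plane n) → Dec (X ≈ Y)
X ≈? Y = ⊑-dec (proj₁ X) (proj₁ Y) (∈ᵖ? X) (∈ᵖ? Y) ×-dec ⊑-dec (proj₁ Y) (proj₁ X) (∈ᵖ? Y) (∈ᵖ? X)

among : (X : Plane n) → u ∈ᵖ X → v ∈ᵖ X → w ∈ᵖ X → u ≢ 0ᵛ → v ≢ 0ᵛ → u ≢ v →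
        w ≡ 0ᵛ ⊎ w ≡ u ⊎ w ≡ v ⊎ w ≡ u + v
among (X , dim) = among-plane {X = X} dim

-- Over 𝔽₂ two distinct non-zero vectors are independent, so a plane through them consists of `0`,
-- `u`, `v` and `u + v`.
plane-⊑ : (X : Plane n) (Y : Subspace n) → u ≢ 0ᵛ → v ≢ 0ᵛ → u ≢ v →
          u ∈ᵖ X → v ∈ᵖ X → u ∈ Y → v ∈ Y → proj₁ X ⊑ Y
plane-⊑ X Y u≢0 v≢0 u≢v uX vX uY vY wX with among X uX vX wX u≢0 v≢0 u≢v
... | inj₁ refl               = 0-closed Y
... | inj₂ (inj₁ refl)        = uY
... | inj₂ (inj₂ (inj₁ refl)) = vY
... | inj₂ (inj₂ (inj₂ refl)) = +-closed Y uY vY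

plane-unique : (X Y : Plane n) → u ≢ 0ᵛ → v ≢ 0ᵛ → u ≢ v →
               u ∈ᵖ X → v ∈ᵖ X → u ∈ᵖ Y → v ∈ᵖ Y → X ≈ Y
plane-unique X Y u≢0 v≢0 u≢v uX vX uY vY =
  plane-⊑ X (proj₁ Y) u≢0 v≢0 u≢v uX vX uY vY , plane-⊑ Y (proj₁ X) u≢0 v≢0 u≢v uY vY uX vX

common-unique : (X Y : Plane n) → ¬ X ≈ Y → u ≢ 0ᵛ → v ≢ 0ᵛ →
                u ∈ᵖ X → u ∈ᵖ Y → v ∈ᵖ X → v ∈ᵖ Y → u ≡ v
common-unique {u = u} {v} X Y X≉Y u≢0 v≢0 uX uY vX vY with u ≟ᵛ v
... | yes u≡v = u≡v
... | no  u≢v = contradiction (plane-unique X Y u≢0 v≢0 u≢v uX vX uY vY) X≉Y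

∈span₁ : (u v : V n) → u ∈ span (u ∷ v ∷ [])
∈span₁ u v = true ∷ false ∷ [] ,
  trans (cong₂ _+_ (·-identityˡ u) (trans (+.identityʳ _) (·-zeroˡ v))) (+.identityʳ u)

∈span₂ : (u v : V n) → v ∈ span (u ∷ v ∷ [])
∈span₂ u v = false ∷ true ∷ [] ,
  trans (cong₂ _+_ (·-zeroˡ u) (trans (+.identityʳ _) (·-identityˡ v))) (+.identityˡ v)

plane : (u v : V n) → u ≢ 0ᵛ → v ≢ 0ᵛ → u ≢ v → Plane n
plane u v u≢0 v≢0 u≢v = span (u ∷ v ∷ []) , u ∷ v ∷ [] , independent₂ u≢0 v≢0 u≢v , id , id

independent₁ : u ≢ 0ᵛ → LinearlyIndependent (u ∷ [])
independent₁ _   (false ∷ []) _  = refl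
independent₁ {u = u} u≢0 (true ∷ [])  eq =
  contradiction (trans (sym (trans (+.identityʳ _) (·-identityˡ u))) eq) u≢0

common-point : (X Y : Plane n) → Adjacent X Y → ∃ λ u → u ≢ 0ᵛ × u ∈ᵖ X × u ∈ᵖ Y
common-point X Y (_ , u ∷ [] , indep , _ , ⊆X∩Y) = u , u≢0 , ⊆X∩Y (∈P u)
  where
  u≢0 : u ≢ 0ᵛ
  u≢0 u≡0 with indep (true ∷ []) (trans (+.identityʳ _) (trans (·-identityˡ u) u≡0))
  ... | ()

-- Distinct planes have at most one non-zero vector in common, so any such vector spans the
-- intersection.
adjacent : (X Y : Plane n) → ¬ X ≈ Y → u ≢ 0ᵛ → u ∈ᵖ X → u ∈ᵖ Y → Adjacent X Y
adjacent {u = u} X Y X≉Y u≢0 uX uY =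
  X≉Y , u ∷ [] , independent₁ u≢0 , ⊆P , P⊑ (proj₁ X ∩ proj₁ Y) (uX , uY)
  where
  ⊆P : proj₁ X ∩ proj₁ Y ⊑ P u
  ⊆P {w} (wX , wY) with w ≟ᵛ 0ᵛ
  ... | yes refl = 0-closed (P u)
  ... | no w≢0   = subst (_∈ P u) (common-unique X Y X≉Y u≢0 w≢0 uX uY wX wY) (∈P u)

another-point : (X : Plane n) (q : V n) → ∃ λ r → r ≢ 0ᵛ × r ≢ q × r ∈ᵖ X
another-point (_ , u ∷ v ∷ [] , indep , _ , ⊆X) q with u ≟ᵛ q
... | no u≢q  = u , u≢0 , u≢q , ⊆X (∈span₁ u v)
  where
  u≢0 : u ≢ 0ᵛ
  u≢0 refl with indep (true ∷ false ∷ []) (proj₂ (∈span₁ u v))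
  ... | ()
... | yes refl = v , v≢0 , v≢u , ⊆X (∈span₂ u v)
  where
  v≢0 : v ≢ 0ᵛ
  v≢0 refl with indep (false ∷ true ∷ []) (proj₂ (∈span₂ u v))
  ... | ()
  v≢u : v ≢ u
  v≢u refl with indep (true ∷ true ∷ []) (trans (cong ((true · u) +_) (+.identityʳ _)) (+-same (true · u)))
  ... | ()

-- Additive maps and the automorphisms they induce

Additive : (V n → V m) → Set
Additive g = ∀ u v → g (u + v) ≡ g u + g v

module _ {g : V n → V m} (g-+ : Additive g) where

  additive-0 : g 0ᵛ ≡ 0ᵛ
  additive-0 = ≡0⇐≡+ (trans (cong g (sym (+.identityˡ 0ᵛ))) (g-+ 0ᵛ 0ᵛ))

  additive-· : ∀ a v → g (a · v) ≡ a · g v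
  additive-· true  v = trans (cong g (·-identityˡ v)) (sym (·-identityˡ (g v)))
  additive-· false v = trans (cong g (·-zeroˡ v)) (trans additive-0 (sym (·-zeroˡ (g v))))

  additive-combination : ∀ as (vs : Vec (V n) k) →
                         g (combination as vs) ≡ combination as (map g vs)
  additive-combination []       []       = additive-0
  additive-combination (a ∷ as) (v ∷ vs) = trans (g-+ _ _)
    (cong₂ _+_ (additive-· a v) (additive-combination as vs))

  additive-injective : (∀ {v} → g v ≡ 0ᵛ → v ≡ 0ᵛ) → Injective _≡_ _≡_ g
  additive-injective ker {u} {v} eq =
    ≡⇐+≡0 (ker (trans (g-+ u v) (trans (cong (_+ g v) eq) (+-same (g v)))))

  comap : Subspace m → Subspace n
  comap X = record
    { Member   = λ v → g v ∈ X
    ; 0-closed = subst (_∈ X) (sym additive-0) (0-closed X)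
    ; +-closed = λ u∈ v∈ → subst (_∈ X) (sym (g-+ _ _)) (+-closed X u∈ v∈)
    ; ·-closed = λ a v∈ → subst (_∈ X) (sym (additive-· a _)) (·-closed X a v∈)
    }

module LinearAutomorphism {n : ℕ} (g g⁻¹ : V n → V n) (g-+ : Additive g)
  (g∘g⁻¹ : ∀ v → g (g⁻¹ v) ≡ v) (g⁻¹∘g : ∀ v → g⁻¹ (g v) ≡ v) where

  g⁻¹-+ : Additive g⁻¹
  g⁻¹-+ u v = trans (cong₂ (λ x y → g⁻¹ (x + y)) (sym (g∘g⁻¹ u)) (sym (g∘g⁻¹ v)))
    (trans (cong g⁻¹ (sym (g-+ _ _))) (g⁻¹∘g _))

  -- This is the image of a subspace under `g`, written as the preimage under `g⁻¹` so that
  -- membership needs no existential.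
  preimage : Subspace n → Subspace n
  preimage = comap {g = g⁻¹} g⁻¹-+

  preimage-dim : ∀ {X} → HasDimension k X → HasDimension k (preimage X)
  preimage-dim {X = X} (vs , indep , X⊆ , ⊆X) =
    map g vs ,
    (λ as eq → indep as (trans (sym (g⁻¹∘g _)) (trans (cong g⁻¹
      (trans (additive-combination g-+ as vs) eq)) (additive-0 g⁻¹-+)))) ,
    (λ {v} v∈ → let as , eq = X⊆ v∈ in
      as , trans (sym (additive-combination g-+ as vs)) (trans (cong g eq) (g∘g⁻¹ v))) ,
    λ { (as , refl) → ⊆X (as , trans (sym (g⁻¹∘g _)) (cong g⁻¹ (additive-combination g-+ as vs))) }

linearAutomorphism : (g g⁻¹ : V n → V n) → Additive g →
                     (∀ v → g (g⁻¹ v) ≡ v) → (∀ v → g⁻¹ (g v) ≡ v) → Automorphism (Γ₂ n)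
linearAutomorphism {n} g g⁻¹ g-+ g∘g⁻¹ g⁻¹∘g = record
  { bijection = record
    { to        = λ (X , dim) → G.preimage X , G.preimage-dim {X = X} dim
    ; from      = λ (X , dim) → G⁻¹.preimage X , G⁻¹.preimage-dim {X = X} dim
    ; to-cong   = λ (X⊑Y , Y⊑X) → (λ v∈ → X⊑Y v∈) , (λ v∈ → Y⊑X v∈)
    ; from-cong = λ (X⊑Y , Y⊑X) → (λ v∈ → X⊑Y v∈) , (λ v∈ → Y⊑X v∈)
    ; inverse   =
        (λ {(X , _)} (Y⊑ , ⊑Y) →
          (λ {v} v∈ → subst (_∈ X) (g∘g⁻¹ v) (Y⊑ v∈)) ,
          (λ {v} v∈ → ⊑Y (subst (_∈ X) (sym (g∘g⁻¹ v)) v∈))) ,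
        (λ {(X , _)} (Y⊑ , ⊑Y) →
          (λ {v} v∈ → subst (_∈ X) (g⁻¹∘g v) (Y⊑ v∈)) ,
          (λ {v} v∈ → ⊑Y (subst (_∈ X) (sym (g⁻¹∘g v)) v∈)))
    }
  ; adjacent-⇔ = λ (X , _) (Y , _) → mk⇔
      (λ (X≉Y , dim) →
        (λ (⊑Y , ⊑X) → X≉Y ((λ {v} v∈ → subst (_∈ Y) (g⁻¹∘g v) (⊑Y (subst (_∈ X) (sym (g⁻¹∘g v)) v∈)))
                          , (λ {v} v∈ → subst (_∈ X) (g⁻¹∘g v) (⊑X (subst (_∈ Y) (sym (g⁻¹∘g v)) v∈))))) ,
        G.preimage-dim {X = X ∩ Y} dim)
      (λ (gX≉gY , dim) →
        (λ (X⊑Y , Y⊑X) → gX≉gY ((λ v∈ → X⊑Y v∈) , (λ v∈ → Y⊑X v∈))) ,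
        HasDimension-resp {X = G⁻¹.preimage (G.preimage (X ∩ Y))} {Y = X ∩ Y}
          ((λ {v} v∈ → subst (_∈ X ∩ Y) (g⁻¹∘g v) v∈)
          , (λ {v} v∈ → subst (_∈ X ∩ Y) (sym (g⁻¹∘g v)) v∈))
          (G⁻¹.preimage-dim {X = G.preimage (X ∩ Y)} dim))
  }
  where
  module G   = LinearAutomorphism g g⁻¹ g-+ g∘g⁻¹ g⁻¹∘g
  module G⁻¹ = LinearAutomorphism g⁻¹ g G.g⁻¹-+ g⁻¹∘g g∘g⁻¹

-- Duality in dimension four

dot : V n → V n → Bool
dot []      []      = false
dot (a ∷ u) (b ∷ v) = (a ∧ b) xor dot u v

infix 4 _⊥ᵛ_
record _⊥ᵛ_ (u v : V n) : Set where
  constructor orthogonal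
  field
    dot≡0 : dot u v ≡ false
open _⊥ᵛ_

_⊥ᵛ?_ : (u v : V n) → Dec (u ⊥ᵛ v)
u ⊥ᵛ? v = map′ orthogonal dot≡0 (dot u v Bool.≟ false)

Among : V n → V n → V n → Set
Among u v w = w ≡ 0ᵛ ⊎ w ≡ u ⊎ w ≡ v ⊎ w ≡ u + v

among? : (u v w : V n) → Dec (Among u v w)
among? u v w = (w ≟ᵛ 0ᵛ) ⊎-dec (w ≟ᵛ u) ⊎-dec (w ≟ᵛ v) ⊎-dec (w ≟ᵛ (u + v))

Distinct : V n → V n → Set
Distinct u v = u ≢ 0ᵛ × v ≢ 0ᵛ × u ≢ v

distinct? : (u v : V n) → Dec (Distinct u v)
distinct? u v = ¬? (u ≟ᵛ 0ᵛ) ×-dec ¬? (v ≟ᵛ 0ᵛ) ×-dec ¬? (u ≟ᵛ v)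

-- Says that `a`, `b` is a basis of the orthogonal complement of `u` and `v`. The negated
-- existential expresses spanning in a form that a finite search decides.
DualBasis : V n → V n → V n → V n → Set
DualBasis u v a b = ((u ⊥ᵛ a × v ⊥ᵛ a) × u ⊥ᵛ b × v ⊥ᵛ b) × Distinct a b ×
  ¬ ∃ λ w → (u ⊥ᵛ w × v ⊥ᵛ w) × ¬ Among a b w

dualBasis? : (u v a b : V n) → Dec (DualBasis u v a b)
dualBasis? u v a b = ((u ⊥ᵛ? a ×-dec v ⊥ᵛ? a) ×-dec u ⊥ᵛ? b ×-dec v ⊥ᵛ? b) ×-dec distinct? a b ×-dec
  ¬? (anySubset? λ w → (u ⊥ᵛ? w ×-dec v ⊥ᵛ? w) ×-dec ¬? (among? a b w))

-- By exhaustive search over 𝔽₂⁴.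
abstract
  dualBasis : {u v : V 4} → Distinct u v → ∃ λ a → ∃ λ b → DualBasis u v a b
  dualBasis {u} {v} d = decidable-stable (anySubset? λ a → anySubset? λ b → dualBasis? u v a b)
    λ none → toWitnessFalse {a? = exception?} _ (u , v , d , none)
    where
    exception? : Dec (∃ λ (u : V 4) → ∃ λ (v : V 4) →
                      Distinct u v × ¬ ∃ λ a → ∃ λ b → DualBasis u v a b)
    exception? = anySubset? λ u → anySubset? λ v → distinct? u v ×-dec
      ¬? (anySubset? λ a → anySubset? λ b → dualBasis? u v a b)

dot-comm : (u v : V n) → dot u v ≡ dot v u
dot-comm []      []      = refl
dot-comm (a ∷ u) (b ∷ v) = cong₂ _xor_ (Bool.∧-comm a b) (dot-comm u v)

dot-0 : (u : V n) → dot u 0ᵛ ≡ false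
dot-0 []      = refl
dot-0 (a ∷ u) = cong₂ _xor_ (Bool.∧-zeroʳ a) (dot-0 u)

dot-+ : (u v w : V n) → dot u (v + w) ≡ dot u v xor dot u w
dot-+ []      []      []      = refl
dot-+ (a ∷ u) (b ∷ v) (c ∷ w) = trans
  (cong₂ _xor_ (Bool.∧-distribˡ-xor a b c) (dot-+ u v w))
  (xor-interchange (a ∧ b) (a ∧ c) (dot u v) (dot u w))
  where
  open CommutativeSemigroupProperties (CommutativeRing.+-commutativeSemigroup Bool.xor-∧-commutativeRing)
    using () renaming (interchange to xor-interchange)

⊥ᵛ-sym : {u v : V n} → u ⊥ᵛ v → v ⊥ᵛ u
⊥ᵛ-sym {u = u} {v} (orthogonal eq) = orthogonal (trans (dot-comm v u) eq)

⊥ᵛ-0 : {u : V n} → u ⊥ᵛ 0ᵛ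
⊥ᵛ-0 {u = u} = orthogonal (dot-0 u)

⊥ᵛ-+ : {u v w : V n} → u ⊥ᵛ v → u ⊥ᵛ w → u ⊥ᵛ (v + w)
⊥ᵛ-+ {u = u} {v} {w} (orthogonal u⊥v) (orthogonal u⊥w) =
  orthogonal (trans (dot-+ u v w) (cong₂ _xor_ u⊥v u⊥w))

⊥ᵛ-· : {u v : V n} → ∀ a → u ⊥ᵛ v → u ⊥ᵛ (a · v)
⊥ᵛ-· {u = u} {v} true  u⊥v = subst (u ⊥ᵛ_) (sym (·-identityˡ v)) u⊥v
⊥ᵛ-· {u = u} {v} false _   = subst (u ⊥ᵛ_) (sym (·-zeroˡ v)) ⊥ᵛ-0

infix 10 _^⊥
_^⊥ : Subspace n → Subspace n
X ^⊥ = record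
  { Member   = λ v → ∀ {x} → x ∈ X → x ⊥ᵛ v
  ; 0-closed = λ _ → ⊥ᵛ-0
  ; +-closed = λ u⊥ v⊥ x∈X → ⊥ᵛ-+ (u⊥ x∈X) (v⊥ x∈X)
  ; ·-closed = λ a v⊥ x∈X → ⊥ᵛ-· a (v⊥ x∈X)
  }

-- The vectors orthogonal to `u` and `v` form a plane with basis `a`, `b`, and the functional
-- `dot w` vanishes at one of `a`, `b`, `a + b`.
⊥ᵛ-third : {u v : V 4} → Distinct u v → ∀ w →
           ∃ λ z → z ≢ 0ᵛ × u ⊥ᵛ z × v ⊥ᵛ z × w ⊥ᵛ z
⊥ᵛ-third {u} {v} d w with dualBasis d
... | a , b , ((ua , va) , (ub , vb)) , (a≢0 , b≢0 , a≢b) , _ with dot w a in wa | dot w b in wb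
... | false | _     = a , a≢0 , ua , va , orthogonal wa
... | true  | false = b , b≢0 , ub , vb , orthogonal wb
... | true  | true  = a + b , ≢⇒+≢0 a≢b , ⊥ᵛ-+ ua ub , ⊥ᵛ-+ va vb ,
  orthogonal (trans (dot-+ w a b) (cong₂ _xor_ wa wb))

basis : (X : Plane n) → ∃ λ u → ∃ λ v → Distinct u v × u ∈ᵖ X × v ∈ᵖ X
basis X =
  let u , u≢0 , _   , uX = another-point X 0ᵛ
      v , v≢0 , v≢u , vX = another-point X u
  in u , v , (u≢0 , v≢0 , v≢u ∘ sym) , uX , vX

⊑⇒≈ : (X Y : Plane n) → proj₁ X ⊑ proj₁ Y → X ≈ Y
⊑⇒≈ X Y X⊑Y = let u , v , (u≢0 , v≢0 , u≢v) , uX , vX = basis X in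
  plane-unique X Y u≢0 v≢0 u≢v uX vX (X⊑Y uX) (X⊑Y vX)

∈P^⊥ : {w z : V n} → w ⊥ᵛ z → w ∈ P z ^⊥
∈P^⊥ w⊥z (a ∷ [] , refl) = ⊥ᵛ-sym (⊥ᵛ-+ (⊥ᵛ-· a w⊥z) ⊥ᵛ-0)

-- The vectors orthogonal to `z` form a subspace, so it contains `X` once it contains a basis of
-- `X`.
∈^⊥ : (X : Plane n) {u v z : V n} → Distinct u v → u ∈ᵖ X → v ∈ᵖ X →
      u ⊥ᵛ z → v ⊥ᵛ z → z ∈ proj₁ X ^⊥
∈^⊥ X {z = z} (u≢0 , v≢0 , u≢v) uX vX u⊥z v⊥z x∈X =
  ⊥ᵛ-sym (plane-⊑ X (P z ^⊥) u≢0 v≢0 u≢v uX vX (∈P^⊥ u⊥z) (∈P^⊥ v⊥z) x∈X (∈P z))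

^⊥-dim : (X : Plane 4) → HasDimension 2 (proj₁ X ^⊥)
^⊥-dim X with basis X
... | u , v , d , uX , vX with dualBasis d
... | a , b , ((ua , va) , (ub , vb)) , (a≢0 , b≢0 , a≢b) , all =
  a ∷ b ∷ [] , independent₂ a≢0 b≢0 a≢b , ⊆span ,
  plane-⊑ (plane a b a≢0 b≢0 a≢b) (proj₁ X ^⊥) a≢0 b≢0 a≢b
    (∈span₁ a b) (∈span₂ a b) (∈^⊥ X d uX vX ua va) (∈^⊥ X d uX vX ub vb)
  where
  ⊆span : proj₁ X ^⊥ ⊑ span (a ∷ b ∷ [])
  ⊆span {w} w⊥ with decidable-stable (among? a b w) (λ ¬a → all (w , (w⊥ uX , w⊥ vX) , ¬a))
  ... | inj₁ refl               = 0-closed (span (a ∷ b ∷ []))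
  ... | inj₂ (inj₁ refl)        = ∈span₁ a b
  ... | inj₂ (inj₂ (inj₁ refl)) = ∈span₂ a b
  ... | inj₂ (inj₂ (inj₂ refl)) = +-closed (span (a ∷ b ∷ [])) (∈span₁ a b) (∈span₂ a b)

perp : Plane 4 → Plane 4
perp X = proj₁ X ^⊥ , ^⊥-dim X

perp-involutive : (X : Plane 4) → X ≈ perp (perp X)
perp-involutive X = ⊑⇒≈ X (perp (perp X)) λ x∈X z⊥ → ⊥ᵛ-sym (z⊥ x∈X)

perp-cong : (X Y : Plane 4) → X ≈ Y → perp X ≈ perp Y
perp-cong X Y (X⊑Y , Y⊑X) = (λ z⊥ x∈ → z⊥ (Y⊑X x∈)) , (λ z⊥ x∈ → z⊥ (X⊑Y x∈))

module ≈ {n : ℕ} = Setoid (Graph.vertices (Γ₂ n)) using (refl; sym; trans)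

perp-cancel : (X Y : Plane 4) → perp X ≈ perp Y → X ≈ Y
perp-cancel X Y eq = ≈.trans {i = X} {perp (perp X)} {Y} (perp-involutive X)
  (≈.trans {i = perp (perp X)} {perp (perp Y)} {Y} (perp-cong (perp X) (perp Y) eq)
    (≈.sym {x = Y} {perp (perp Y)} (perp-involutive Y)))

-- Planes that meet in `p` are spanned together by three vectors `p`, `x`, `y`. In 𝔽₂⁴ these have a
-- common orthogonal vector `z`, which lies in both complements.
perp-adjacent : (X Y : Plane 4) → Adjacent X Y → Adjacent (perp X) (perp Y)
perp-adjacent X Y adj@(X≉Y , _) =
  let p , p≢0 , pX , pY = common-point X Y adj
      x , x≢0 , x≢p , xX = another-point X p
      y , y≢0 , y≢p , yY = another-point Y p
      z , z≢0 , p⊥z , x⊥z , y⊥z = ⊥ᵛ-third (p≢0 , x≢0 , x≢p ∘ sym) y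
  in adjacent (perp X) (perp Y) (λ eq → X≉Y (perp-cancel X Y eq)) z≢0
       (∈^⊥ X (p≢0 , x≢0 , x≢p ∘ sym) pX xX p⊥z x⊥z) (∈^⊥ Y (p≢0 , y≢0 , y≢p ∘ sym) pY yY p⊥z y⊥z)

duality : Automorphism (Γ₂ 4)
duality = record
  { bijection = record
    { to        = perp
    ; from      = perp
    ; to-cong   = λ {X Y} → perp-cong X Y
    ; from-cong = λ {X Y} → perp-cong X Y
    ; inverse   = (λ {X Y} → inv X Y) , (λ {X Y} → inv X Y)
    }
  -- The converse is the forward direction for the complements, transported back along
  -- `perp-involutive`.
  ; adjacent-⇔ = λ X Y → mk⇔ (perp-adjacent X Y) λ adj →
      let X≉Y , dim = perp-adjacent (perp X) (perp Y) adj in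
      (λ X≈Y → proj₁ adj (perp-cong X Y X≈Y)) ,
      HasDimension-resp {X = proj₁ (perp (perp X)) ∩ proj₁ (perp (perp Y))} {Y = proj₁ X ∩ proj₁ Y}
        ( (λ (a , b) → proj₂ (perp-involutive X) a , proj₂ (perp-involutive Y) b)
        , (λ (a , b) → proj₁ (perp-involutive X) a , proj₁ (perp-involutive Y) b)) dim
  }
  where
  inv : (X Y : Plane 4) → Y ≈ perp X → perp Y ≈ X
  inv X Y eq = ≈.trans {i = perp Y} {perp (perp X)} {X} (perp-cong Y (perp X) eq)
    (≈.sym {x = X} {perp (perp X)} (perp-involutive X))

-- Functions on the parts of partitions

lookup-+ : ∀ (u v : V n) i → lookup (u + v) i ≡ lookup u i xor lookup v i
lookup-+ u v i = Vec.lookup-zipWith _xor_ i u v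

lookup-⁅⁆ : (i : Fin n) → lookup ⁅ i ⁆ i ≡ true
lookup-⁅⁆ i = Vec.[]=⇒lookup (x∈⁅x⁆ i)

lookup-⁅⁆-≢ : {i j : Fin n} → i ≢ j → lookup ⁅ i ⁆ j ≡ false
lookup-⁅⁆-≢ {i = i} {j} i≢j = Bool.¬-not λ eq →
  i≢j (sym (x∈⁅y⁆⇒x≡y i (Vec.lookup⇒[]= j ⁅ i ⁆ eq)))

⁅⁆≢0 : (i : Fin n) → ⁅ i ⁆ ≢ 0ᵛ
⁅⁆≢0 i eq with trans (sym (lookup-⁅⁆ i)) (trans (cong (λ v → lookup v i) eq) (Vec.lookup-replicate i false))
... | ()

record Disjoint (u v : V n) : Set where
  constructor disjoint
  field
    never-both : ∀ i → lookup u i ≡ true → ¬ lookup v i ≡ true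

Disjoint-sym : Disjoint u v → Disjoint v u
Disjoint-sym (disjoint u#v) = disjoint λ i vᵢ uᵢ → u#v i uᵢ vᵢ

Disjoint-+ : Disjoint u v → Disjoint u w → Disjoint u (v + w)
Disjoint-+ {u = u} {v} {w} (disjoint u#v) (disjoint u#w) = disjoint both
  where
  both : ∀ i → lookup u i ≡ true → ¬ lookup (v + w) i ≡ true
  both i uᵢ v+wᵢ with lookup v i in vᵢ | lookup w i in wᵢ
  ... | true  | _     = u#v i uᵢ vᵢ
  ... | false | true  = u#w i uᵢ wᵢ
  ... | false | false = contradiction
    (trans (sym v+wᵢ) (trans (lookup-+ v w i) (cong₂ _xor_ vᵢ wᵢ))) λ ()

Disjoint-⁅⁆ : ∀ u {i : Fin n} → lookup u i ≡ false → Disjoint u ⁅ i ⁆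
Disjoint-⁅⁆ u {i} i∉u = disjoint both
  where
  both : ∀ j → lookup u j ≡ true → ¬ lookup ⁅ i ⁆ j ≡ true
  both j uⱼ ⁅i⁆ⱼ with i Fin.≟ j
  ... | yes refl = contradiction (trans (sym uⱼ) i∉u) λ ()
  ... | no i≢j   = contradiction (trans (sym ⁅i⁆ⱼ) (lookup-⁅⁆-≢ i≢j)) λ ()

Disjoint⇒≢ : u ≢ 0ᵛ → Disjoint u v → u ≢ v
Disjoint⇒≢ u≢0 (disjoint u#u) refl =
  let i , i∈u = nonempty u≢0 ; uᵢ = Vec.[]=⇒lookup i∈u in u#u i uᵢ uᵢ

missing⇒≢⊤ : ∀ (u : V n) {i} → lookup u i ≡ false → u ≢ ⊤
missing⇒≢⊤ _ {i} i∉u refl = contradiction (trans (sym i∉u) (Vec.lookup-replicate i true)) λ ()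

∣+∣≤∣∣+∣∣ : (u v : V n) → ∣ u + v ∣ ≤ ∣ u ∣ ℕ.+ ∣ v ∣
∣+∣≤∣∣+∣∣ []          []          = z≤n
∣+∣≤∣∣+∣∣ (false ∷ u) (false ∷ v) = ∣+∣≤∣∣+∣∣ u v
∣+∣≤∣∣+∣∣ (true  ∷ u) (false ∷ v) = s≤s (∣+∣≤∣∣+∣∣ u v)
∣+∣≤∣∣+∣∣ (false ∷ u) (true  ∷ v) =
  subst (suc ∣ u + v ∣ ≤_) (sym (ℕ.+-suc ∣ u ∣ ∣ v ∣)) (s≤s (∣+∣≤∣∣+∣∣ u v))
∣+∣≤∣∣+∣∣ (true  ∷ u) (true  ∷ v) =
  ℕ.≤-trans (∣+∣≤∣∣+∣∣ u v) (ℕ.+-mono-≤ (ℕ.n≤1+n _) (ℕ.n≤1+n _))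

-- A symmetric difference of three singletons has at most three elements.
three-singletons≢⊤ : 4 ≤ n → (a b c : Fin n) → ⁅ a ⁆ + (⁅ b ⁆ + ⁅ c ⁆) ≢ ⊤
three-singletons≢⊤ {n} 4≤n a b c eq = ℕ.<⇒≱ 4≤n (begin
  n                                     ≡⟨ ∣⊤∣≡n n ⟨
  ∣ ⊤ {n} ∣                             ≡⟨ cong ∣_∣ eq ⟨
  ∣ ⁅ a ⁆ + (⁅ b ⁆ + ⁅ c ⁆) ∣           ≤⟨ ∣+∣≤∣∣+∣∣ ⁅ a ⁆ _ ⟩
  ∣ ⁅ a ⁆ ∣ ℕ.+ ∣ ⁅ b ⁆ + ⁅ c ⁆ ∣       ≤⟨ ℕ.+-monoʳ-≤ ∣ ⁅ a ⁆ ∣ (∣+∣≤∣∣+∣∣ ⁅ b ⁆ ⁅ c ⁆) ⟩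
  ∣ ⁅ a ⁆ ∣ ℕ.+ (∣ ⁅ b ⁆ ∣ ℕ.+ ∣ ⁅ c ⁆ ∣)
    ≡⟨ cong₂ ℕ._+_ (∣⁅x⁆∣≡1 a) (cong₂ ℕ._+_ (∣⁅x⁆∣≡1 b) (∣⁅x⁆∣≡1 c)) ⟩
  3                                     ∎)
  where open ℕ.≤-Reasoning

subset-induction : (R : V n → Set) → R 0ᵛ →
                   (∀ A b → lookup A b ≡ false → R A → R (A + ⁅ b ⁆)) → ∀ S → R S
subset-induction R base step []          = base
subset-induction R base step (false ∷ S) = subset-induction (R ∘ (false ∷_)) base
  (λ A b → step (false ∷ A) (suc b)) S
subset-induction R base step (true  ∷ S) = subset-induction (R ∘ (true ∷_))
  (subst (R ∘ (true ∷_)) (+.identityˡ 0ᵛ) (step 0ᵛ zero refl base)) (λ A b → step (true ∷ A) (suc b)) S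

combination-⁅⁆ : ∀ (g : Fin k → V n) b → combination ⁅ b ⁆ (tabulate g) ≡ g b
combination-⁅⁆ g zero    = trans
  (cong₂ _+_ (·-identityˡ (g zero)) (combination-0 (tabulate (g ∘ suc)))) (+.identityʳ (g zero))
combination-⁅⁆ g (suc b) = trans
  (cong₂ _+_ (·-zeroˡ (g zero)) (combination-⁅⁆ (g ∘ suc) b)) (+.identityˡ _)

-- If K X + K Y + K Z = 0 for every partition of the coordinates into three
-- non-empty parts, then K X + K Y + K (X + Y) is a constant η on disjoint X and Y
-- that omit at least two coordinates, and K + η is additive.
module PartitionSums {m : ℕ} (K : V (4 ℕ.+ m) → V n)
  (K-+ : ∀ {A B} → A ≢ 0ᵛ → B ≢ 0ᵛ → Disjoint A B → A + B ≢ ⊤ → K A + K B ≡ K (∁ (A + B)))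
  where

  private
    variable
      A B C : V (4 ℕ.+ m)
      a b c d : Fin (4 ℕ.+ m)

  defect : V (4 ℕ.+ m) → V (4 ℕ.+ m) → V n
  defect A B = (K A + K B) + K (A + B)

  defect-comm : ∀ A B → defect A B ≡ defect B A
  defect-comm A B = cong₂ _+_ (+.comm (K A) (K B)) (cong K (+.comm A B))

  +-swapˡ : ∀ {k} (u v w : V k) → u + (v + w) ≡ v + (u + w)
  +-swapˡ u v w = trans (sym (+.assoc u v w)) (trans (cong (_+ w) (+.comm u v)) (+.assoc v u w))

  -- The partitions into `A`, `B + C`, rest and into `B`, `A + C`, rest have the same third part, so
  -- `K A + K (B + C)` equals `K B + K (A + C)`.
  defect-exchange : A ≢ 0ᵛ → B ≢ 0ᵛ → C ≢ 0ᵛ → Disjoint A B → Disjoint A C → Disjoint B C →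
                    A + (B + C) ≢ ⊤ → defect B C ≡ defect A C
  defect-exchange {A} {B} {C} A≢0 B≢0 C≢0 A#B A#C B#C ≢⊤ = rearrange (K A) (K B) (K C) _ _ (begin
    K A + K (B + C)      ≡⟨ K-+ A≢0 (≢⇒+≢0 (Disjoint⇒≢ B≢0 B#C)) (Disjoint-+ A#B A#C) ≢⊤ ⟩
    K (∁ (A + (B + C)))  ≡⟨ cong (K ∘ ∁) (+-swapˡ A B C) ⟩
    K (∁ (B + (A + C)))  ≡⟨ K-+ B≢0 (≢⇒+≢0 (Disjoint⇒≢ A≢0 A#C)) (Disjoint-+ (Disjoint-sym A#B) B#C)
                              (≢⊤ ∘ trans (+-swapˡ A B C)) ⟨
    K B + K (A + C)      ∎)
    where
    open ≡-Reasoning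
    rearrange : ∀ {k} (a b c x y : V k) → a + x ≡ b + y → (b + c) + x ≡ (a + c) + y
    rearrange a b c x y eq = begin
      (b + c) + x              ≡⟨ cong ((b + c) +_) (x+y≡z⇒y≡x+z eq) ⟩
      (b + c) + (a + (b + y))  ≡⟨ cong ((b + c) +_) (+-swapˡ a b y) ⟩
      (b + c) + (b + (a + y))  ≡⟨ +.interchange b c b (a + y) ⟩
      (b + b) + (c + (a + y))  ≡⟨ cong₂ _+_ (+-same b) (+-swapˡ c a y) ⟩
      0ᵛ + (a + (c + y))       ≡⟨ +.identityˡ _ ⟩
      a + (c + y)              ≡⟨ +.assoc a c y ⟨
      (a + c) + y              ∎

  η : V n
  η = defect ⁅ zero ⁆ ⁅ suc zero ⁆

  defect-⁅⁆-exchange : ∀ b c a → b ≢ c → a ≢ c → defect ⁅ b ⁆ ⁅ c ⁆ ≡ defect ⁅ a ⁆ ⁅ c ⁆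
  defect-⁅⁆-exchange b c a b≢c a≢c with a Fin.≟ b
  ... | yes refl = refl
  ... | no a≢b   = defect-exchange (⁅⁆≢0 a) (⁅⁆≢0 b) (⁅⁆≢0 c)
    (Disjoint-⁅⁆ ⁅ a ⁆ (lookup-⁅⁆-≢ a≢b)) (Disjoint-⁅⁆ ⁅ a ⁆ (lookup-⁅⁆-≢ a≢c))
    (Disjoint-⁅⁆ ⁅ b ⁆ (lookup-⁅⁆-≢ b≢c))
    (three-singletons≢⊤ (s≤s (s≤s (s≤s (s≤s z≤n)))) a b c)

  -- Exchanging one singleton at a time leads from any pair to the pair that defines `η`. Four
  -- coordinates leave room for each exchange.
  defect-⁅⁆ : b ≢ c → defect ⁅ b ⁆ ⁅ c ⁆ ≡ η
  defect-⁅⁆ {b} {zero} b≢0 =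
    trans (defect-⁅⁆-exchange b zero (suc zero) b≢0 λ ()) (defect-comm ⁅ suc zero ⁆ ⁅ zero ⁆)
  defect-⁅⁆ {b} {c@(suc _)} b≢c = begin
    defect ⁅ b ⁆ ⁅ c ⁆            ≡⟨ defect-⁅⁆-exchange b c zero b≢c (λ ()) ⟩
    defect ⁅ zero ⁆ ⁅ c ⁆         ≡⟨ defect-comm ⁅ zero ⁆ ⁅ c ⁆ ⟩
    defect ⁅ c ⁆ ⁅ zero ⁆         ≡⟨ defect-⁅⁆-exchange c zero (suc zero) (λ ()) (λ ()) ⟩
    defect ⁅ suc zero ⁆ ⁅ zero ⁆  ≡⟨ defect-comm ⁅ suc zero ⁆ ⁅ zero ⁆ ⟩
    η                             ∎
    where open ≡-Reasoning

  abstract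
    F : V (4 ℕ.+ m) → V n
    F A = combination A (tabulate λ b → K ⁅ b ⁆ + η)

    F-+ : Additive F
    F-+ A B = combination-+ A B _

    F-⁅⁆ : ∀ b → F ⁅ b ⁆ ≡ K ⁅ b ⁆ + η
    F-⁅⁆ = combination-⁅⁆ (λ b → K ⁅ b ⁆ + η)

  -- Induction on the elements of `A`. When `b` is added, `⁅ c ⁆` replaces `A` in `defect A ⁅ b ⁆`,
  -- which leaves a defect of two singletons, and `d` keeps the union of the three sets proper.
  K+η : ∀ A → A ≢ 0ᵛ → c ≢ d → lookup A c ≡ false → lookup A d ≡ false → K A + η ≡ F A
  K+η {c} {d} A A≢0 c≢d = subset-induction R (λ 0≢0 → contradiction refl 0≢0) step A A≢0
    where
    R : V (4 ℕ.+ m) → Set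
    R A = A ≢ 0ᵛ → lookup A c ≡ false → lookup A d ≡ false → K A + η ≡ F A

    shrink : ∀ {A b e} → lookup A b ≡ false → lookup (A + ⁅ b ⁆) e ≡ false →
             e ≢ b × lookup A e ≡ false
    shrink {A} {b} {e} b∉A e∉ with e Fin.≟ b
    ... | yes refl = contradiction
      (trans (sym e∉) (trans (lookup-+ A ⁅ b ⁆ b) (cong₂ _xor_ b∉A (lookup-⁅⁆ b)))) λ ()
    ... | no e≢b = e≢b , (begin
      lookup A e                       ≡⟨ Bool.xor-identityʳ _ ⟨
      lookup A e xor false             ≡⟨ cong (lookup A e xor_) (lookup-⁅⁆-≢ (e≢b ∘ sym)) ⟨
      lookup A e xor lookup ⁅ b ⁆ e    ≡⟨ lookup-+ A ⁅ b ⁆ e ⟨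
      lookup (A + ⁅ b ⁆) e             ≡⟨ e∉ ⟩
      false                            ∎)
      where open ≡-Reasoning

    step : ∀ A b → lookup A b ≡ false → R A → R (A + ⁅ b ⁆)
    step A b b∉A IH _ c∉ d∉ with shrink {A} b∉A c∉ | shrink {A} b∉A d∉ | A ≟ᵛ 0ᵛ
    ... | _ | _ | yes refl = subst (λ B → K B + η ≡ F B) (sym (+.identityˡ ⁅ b ⁆)) (sym (F-⁅⁆ b))
    ... | c≢b , c∉A | d≢b , d∉A | no A≢0 = begin
      K (A + ⁅ b ⁆) + η                    ≡⟨ cong (_+ η) (x+y≡z⇒y≡x+z defect≡η) ⟩
      ((K A + K ⁅ b ⁆) + η) + η            ≡⟨ +.assoc _ η η ⟩
      (K A + K ⁅ b ⁆) + (η + η)            ≡⟨ +.interchange (K A) (K ⁅ b ⁆) η η ⟩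
      (K A + η) + (K ⁅ b ⁆ + η)            ≡⟨ cong₂ _+_ (IH A≢0 c∉A d∉A) (sym (F-⁅⁆ b)) ⟩
      F A + F ⁅ b ⁆                        ≡⟨ F-+ A ⁅ b ⁆ ⟨
      F (A + ⁅ b ⁆)                        ∎
      where
      open ≡-Reasoning
      d∉c+A+b : lookup (⁅ c ⁆ + (A + ⁅ b ⁆)) d ≡ false
      d∉c+A+b = trans (lookup-+ ⁅ c ⁆ (A + ⁅ b ⁆) d) (cong₂ _xor_ (lookup-⁅⁆-≢ c≢d) d∉)

      defect≡η : defect A ⁅ b ⁆ ≡ η
      defect≡η = trans
        (defect-exchange (⁅⁆≢0 c) A≢0 (⁅⁆≢0 b) (Disjoint-sym (Disjoint-⁅⁆ A c∉A))
          (Disjoint-⁅⁆ ⁅ c ⁆ (lookup-⁅⁆-≢ c≢b)) (Disjoint-⁅⁆ A b∉A) (missing⇒≢⊤ _ d∉c+A+b))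
        (defect-⁅⁆ c≢b)

  -- Sum `F` over the parts `e₀`, `e₁` and the rest: the values of `K` cancel, and three copies of
  -- `η` remain.
  F-⊤ : F ⊤ ≡ η
  F-⊤ = cancel (F ⊤) (K e₀ + K e₁) (begin
    F ⊤ + (K e₀ + K e₁)              ≡⟨ cong (F ⊤ +_) (sym (trans (cong ((K e₀ + K e₁) +_) (+-same η)) (+.identityʳ _))) ⟩
    F ⊤ + ((K e₀ + K e₁) + (η + η))  ≡⟨ cong (F ⊤ +_) (+.interchange (K e₀) (K e₁) η η) ⟩
    F ⊤ + ((K e₀ + η) + (K e₁ + η))  ≡⟨ cong (F ⊤ +_) (cong₂ _+_ (sym (F-⁅⁆ zero)) (sym (F-⁅⁆ (suc zero)))) ⟩
    F ⊤ + (F e₀ + F e₁)              ≡⟨ cong (F ⊤ +_) (F-+ e₀ e₁) ⟨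
    F ⊤ + F (e₀ + e₁)                ≡⟨ F-+ ⊤ (e₀ + e₁) ⟨
    F (⊤ + (e₀ + e₁))                ≡⟨ cong F (∁≡⊤+ (e₀ + e₁)) ⟨
    F (∁ (e₀ + e₁))                  ≡⟨ K+η {zero} {suc zero} (∁ (e₀ + e₁)) (λ ()) (λ ()) refl refl ⟨
    K (∁ (e₀ + e₁)) + η              ≡⟨ cong (_+ η) (K-+ (λ ()) (λ ()) (Disjoint-⁅⁆ e₀ {suc zero} refl) (λ ())) ⟨
    (K e₀ + K e₁) + η                ≡⟨ +.comm _ η ⟩
    η + (K e₀ + K e₁)                ∎)
    where
    open ≡-Reasoning
    e₀ = ⁅ zero ⁆
    e₁ = ⁅ suc zero ⁆
    cancel : ∀ {k} (u {v} w : V k) → u + w ≡ v + w → u ≡ v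
    cancel u {v} w eq = trans (sym (+-cancel u w)) (trans (cong (_+ w) eq) (+-cancel v w))

  -- Since `η` is `F ⊤`, adding it amounts to passing to the complement.
  K≡F∁ : ∀ A → A ≢ 0ᵛ → c ≢ d → lookup A c ≡ false → lookup A d ≡ false → K A ≡ F (∁ A)
  K≡F∁ A A≢0 c≢d c∉ d∉ = begin
    K A              ≡⟨ +-cancel (K A) η ⟨
    (K A + η) + η    ≡⟨ cong (_+ η) (K+η A A≢0 c≢d c∉ d∉) ⟩
    F A + η          ≡⟨ cong (F A +_) F-⊤ ⟨
    F A + F ⊤        ≡⟨ +.comm _ _ ⟩
    F ⊤ + F A        ≡⟨ F-+ ⊤ A ⟨
    F (⊤ + A)        ≡⟨ cong F (∁≡⊤+ A) ⟨
    F (∁ A)          ∎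
    where open ≡-Reasoning

-- Codes

lookup-⊤ : (i : Fin n) → lookup ⊤ i ≡ true
lookup-⊤ i = Vec.lookup-replicate i true

lookup-∁ : ∀ (u : V n) i → lookup (∁ u) i ≡ not (lookup u i)
lookup-∁ u i = Vec.lookup-map i not u

∁-involutive : (u : V n) → ∁ (∁ u) ≡ u
∁-involutive u = trans (∁≡⊤+ (∁ u)) (trans (cong (⊤ +_) (∁≡⊤+ u)) (⊤+-involutive u))

≢0⇒∁≢⊤ : u ≢ 0ᵛ → ∁ u ≢ ⊤
≢0⇒∁≢⊤ {u = u} u≢0 eq = u≢0 (trans (sym (∁-involutive u)) (trans (cong ∁ eq) (∁-⊤ _)))
  where
  ∁-⊤ : ∀ n → ∁ (⊤ {n}) ≡ 0ᵛ
  ∁-⊤ n = trans (∁≡⊤+ ⊤) (+-same ⊤)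

≢⊤⇒∁≢0 : u ≢ ⊤ → ∁ u ≢ 0ᵛ
≢⊤⇒∁≢0 {u = u} u≢⊤ eq = u≢⊤ (sym (≡⇐+≡0 (trans (sym (∁≡⊤+ u)) eq)))

missing : u ≢ ⊤ → ∃ λ i → lookup u i ≡ false
missing {u = u} u≢⊤ = let i , i∈∁u = nonempty (≢⊤⇒∁≢0 u≢⊤) in
  i , Bool.not-injective (trans (sym (lookup-∁ u i)) (Vec.[]=⇒lookup i∈∁u))

infix 4 _∈ᶜ_
_∈ᶜ_ : V n → Code n → Set
v ∈ᶜ X = v ∈ ⟦ X ⟧

⊤∈⇒nonDegenerate : (X : Subspace n) → ⊤ ∈ X → NonDegenerate X
⊤∈⇒nonDegenerate X ⊤∈X i X⊑ = contradiction (trans (sym (lookup-⊤ i)) (X⊑ ⊤∈X)) λ ()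

-- If `u` and `v` both vanished at `i`, the whole code would lie in the `i`-th coordinate
-- hyperplane.
covering : (X : Code n) → u ≢ 0ᵛ → v ≢ 0ᵛ → u ≢ v → u ∈ᶜ X → v ∈ᶜ X →
           ∀ i → lookup u i ≡ false → lookup v i ≡ true
covering {v = v} (X , nd) u≢0 v≢0 u≢v uX vX i uᵢ with lookup v i in vᵢ
... | true  = refl
... | false = contradiction (λ {w} → plane-⊑ X (coordinateHyperplane i) u≢0 v≢0 u≢v uX vX uᵢ vᵢ {w}) (nd i)

code : (u v : V n) → u ≢ 0ᵛ → v ≢ 0ᵛ → u ≢ v →
       (∀ i → lookup u i ≡ false → lookup v i ≡ true) → Code n
code u v u≢0 v≢0 u≢v cover = plane u v u≢0 v≢0 u≢v , λ i X⊑ → contradiction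
  (trans (sym (X⊑ (∈span₂ u v))) (cover i (X⊑ (∈span₁ u v)))) λ ()

⊤∉code : ∀ {u v : V (suc n)} u≢0 v≢0 u≢v cover → u ≢ ⊤ → v ≢ ⊤ → u + v ≢ ⊤ →
         ¬ ⊤ ∈ᶜ code u v u≢0 v≢0 u≢v cover
⊤∉code {u = u} {v} u≢0 v≢0 u≢v cover u≢⊤ v≢⊤ u+v≢⊤ ⊤∈
  with among (plane u v u≢0 v≢0 u≢v) (∈span₁ u v) (∈span₂ u v) ⊤∈ u≢0 v≢0 u≢v
... | inj₁ ()
... | inj₂ (inj₁ eq)        = u≢⊤ (sym eq)
... | inj₂ (inj₂ (inj₁ eq)) = v≢⊤ (sym eq)
... | inj₂ (inj₂ (inj₂ eq)) = u+v≢⊤ (sym eq)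

Proper : V n → Set
Proper p = p ≢ 0ᵛ × p ≢ ⊤

∁-proper : Proper p → Proper (∁ p)
∁-proper (p≢0 , p≢⊤) = ≢⊤⇒∁≢0 p≢⊤ , ≢0⇒∁≢⊤ p≢0

⊤≢0 : ⊤ {suc n} ≢ 0ᵛ
⊤≢0 ()

representative : (p : V (suc (suc n))) → ∃ λ r → Proper r × p ∈ span (⊤ ∷ r ∷ [])
representative p with p ≟ᵛ 0ᵛ | p ≟ᵛ ⊤
... | no p≢0   | no p≢⊤   = p , (p≢0 , p≢⊤) , ∈span₂ ⊤ p
-- The vectors `0` and `⊤` do not single out a code through `⊤`; `⁅ zero ⁆` serves as a default.
... | yes refl | _        = ⁅ zero ⁆ , ((λ ()) , λ ()) , 0-closed (span (⊤ ∷ ⁅ zero ⁆ ∷ []))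
... | no _     | yes refl = ⁅ zero ⁆ , ((λ ()) , λ ()) , ∈span₁ ⊤ ⁅ zero ⁆

abstract
  -- The code through ⊤ and p; for p = 0 and p = ⊤ an arbitrary code through ⊤.
  pencil : V (suc (suc n)) → Code (suc (suc n))
  pencil p = let r , (r≢0 , r≢⊤) , _ = representative p in
    plane ⊤ r ⊤≢0 r≢0 (r≢⊤ ∘ sym) , ⊤∈⇒nonDegenerate (span (⊤ ∷ r ∷ [])) (∈span₁ ⊤ r)

  ⊤∈pencil : (p : V (suc (suc n))) → ⊤ ∈ᶜ pencil p
  ⊤∈pencil p = ∈span₁ ⊤ (proj₁ (representative p))

  ∈pencil : (p : V (suc (suc n))) → p ∈ᶜ pencil p
  ∈pencil p = proj₂ (proj₂ (representative p))

pencil-unique : (X : Code (suc (suc n))) → Proper p → ⊤ ∈ᶜ X → p ∈ᶜ X → inclusion X ≈ inclusion (pencil p)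
pencil-unique {p = p} X (p≢0 , p≢⊤) ⊤X pX =
  plane-unique (inclusion X) (inclusion (pencil p)) ⊤≢0 p≢0 (p≢⊤ ∘ sym) ⊤X pX (⊤∈pencil p) (∈pencil p)

∁-pencil : {p : V (suc (suc n))} → Proper p → inclusion (pencil p) ≈ inclusion (pencil (∁ p))
∁-pencil {p = p} pr = pencil-unique (pencil p) (∁-proper pr) (⊤∈pencil p)
  (subst (_∈ᶜ pencil p) (sym (∁≡⊤+ p)) (+-closed ⟦ pencil p ⟧ (⊤∈pencil p) (∈pencil p)))

pencil-≡ : {p q : V (suc (suc n))} → Proper p → Proper q → inclusion (pencil p) ≈ inclusion (pencil q) →
           q ≡ p ⊎ q ≡ ⊤ + p
pencil-≡ {p = p} {q} (p≢0 , p≢⊤) (q≢0 , q≢⊤) (_ , ⊑)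
  with among (inclusion (pencil p)) (⊤∈pencil p) (∈pencil p) (⊑ (∈pencil q)) ⊤≢0 p≢0 (p≢⊤ ∘ sym)
... | inj₁ q≡0               = contradiction q≡0 q≢0
... | inj₂ (inj₁ q≡⊤)        = contradiction q≡⊤ q≢⊤
... | inj₂ (inj₂ (inj₁ q≡p)) = inj₁ q≡p
... | inj₂ (inj₂ (inj₂ eq))  = inj₂ eq

-- The functional with kernel `H`

⊤∉H : ¬ ⊤ ∈ H {suc n}
⊤∉H {n} ⊤∈H = ℕ.1+n≰n (injective⇒≤-dim {g = coefficients} λ {u} {v} eq →
  trans (sym (proj₂ (all∈H u))) (trans (cong (λ as → combination as _) eq) (proj₂ (all∈H v))))
  where
  all∈H : ∀ v → v ∈ H {suc n}
  all∈H v = +ₛ-least (H {suc n}) Q (H {suc n}) id (P⊑ (H {suc n}) ⊤∈H) (H+Q v)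

  coefficients : V (suc n) → V n
  coefficients v = proj₁ (all∈H v)

abstract
  χ : V n → Bool
  χ v = not (does (H? v))

  χ-∈ : v ∈ H → χ v ≡ false
  χ-∈ {v = v} v∈H = cong not (dec-true (H? v) v∈H)

  χ-∉ : ¬ v ∈ H → χ v ≡ true
  χ-∉ {v = v} v∉H = cong not (dec-false (H? v) v∉H)

-- `H` has index two: the sum of two vectors outside `H` lies in `H`.
χ-+ : ∀ (u v : V n) → χ (u + v) ≡ χ u xor χ v
χ-+ {n} u v = by-cases (H? u) (H? v)
  where
  by-cases : Dec (u ∈ H) → Dec (v ∈ H) → χ (u + v) ≡ χ u xor χ v
  by-cases (yes u∈) (yes v∈) = trans (χ-∈ (+-closed (H {n}) u∈ v∈)) (sym (cong₂ _xor_ (χ-∈ u∈) (χ-∈ v∈)))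
  by-cases (yes u∈) (no  v∉) = trans
    (χ-∉ λ u+v∈ → v∉ (subst (_∈ H) (+-cancelˡ u v) (+-closed (H {n}) u∈ u+v∈)))
    (sym (cong₂ _xor_ (χ-∈ u∈) (χ-∉ v∉)))
  by-cases (no  u∉) (yes v∈) = trans
    (χ-∉ λ u+v∈ → u∉ (subst (_∈ H) (+-cancel u v) (+-closed (H {n}) u+v∈ v∈)))
    (sym (cong₂ _xor_ (χ-∉ u∉) (χ-∈ v∈)))
  by-cases (no  u∉) (no  v∉) = trans (χ-∈ (∉H+∉H u∉ v∉)) (sym (cong₂ _xor_ (χ-∉ u∉) (χ-∉ v∉)))

-- Codes that avoid `⊤`

Transversal : Code n → Set
Transversal X = ¬ ⊤ ∈ᶜ X

transversal-proper : ∀ (X : Code n) → Transversal X → p ≢ 0ᵛ → p ∈ᶜ X → Proper p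
transversal-proper X ⊤∉X p≢0 pX = p≢0 , λ { refl → ⊤∉X pX }

-- An explicit criterion for being a non-zero vector of some code that avoids `⊤`. The proper
-- vectors that fail it are the singletons.
OnTransversal : V n → Set
OnTransversal p = p ≢ ⊤ × ∃₂ λ i j → i ≢ j × lookup p i ≡ true × lookup p j ≡ true

onTransversal? : ∀ (p : V n) → Dec (OnTransversal p)
onTransversal? p = ¬? (p ≟ᵛ ⊤) ×-dec any? λ i → any? λ j →
  ¬? (i Fin.≟ j) ×-dec (lookup p i Bool.≟ true) ×-dec (lookup p j Bool.≟ true)

-- The other non-zero vectors `r` and `p + r` each miss a coordinate, where `p` must then be 1.
-- These coordinates differ, because `p` would vanish at one missed by both.
transversal-on : ∀ (X : Code n) → Transversal X → p ≢ 0ᵛ → p ∈ᶜ X → OnTransversal p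
transversal-on {p = p} X ⊤∉X p≢0 pX with another-point (inclusion X) p
... | r , r≢0 , r≢p , rX =
  proj₂ (transversal-proper X ⊤∉X p≢0 pX) , j , i , j≢i , pⱼ , pᵢ
  where
  rᵢ = missing (proj₂ (transversal-proper X ⊤∉X r≢0 rX))
  i  = proj₁ rᵢ
  p+rⱼ = missing (proj₂ (transversal-proper X ⊤∉X (≢⇒+≢0 (r≢p ∘ sym)) (+-closed ⟦ X ⟧ pX rX)))
  j  = proj₁ p+rⱼ
  pᵢ : lookup p i ≡ true
  pᵢ = covering X r≢0 p≢0 r≢p rX pX i (proj₂ rᵢ)
  pⱼ : lookup p j ≡ true
  pⱼ = covering X (≢⇒+≢0 (r≢p ∘ sym)) p≢0 (r≢0 ∘ ≡0⇐≡+ ∘ sym) (+-closed ⟦ X ⟧ pX rX) pX j (proj₂ p+rⱼ)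
  j≢i : j ≢ i
  j≢i j≡i = contradiction (begin
    true                       ≡⟨ cong₂ _xor_ pⱼ (trans (cong (lookup r) j≡i) (proj₂ rᵢ)) ⟨
    lookup p j xor lookup r j  ≡⟨ lookup-+ p r j ⟨
    lookup (p + r) j           ≡⟨ proj₂ p+rⱼ ⟩
    false                      ∎) λ ()
    where open ≡-Reasoning

-- The second generator `e` misses only `i`, which `p` covers, and `p + e` misses `j`. Hence the
-- code is non-degenerate and avoids `⊤`.
transversalThrough : {p : V (suc n)} → OnTransversal p → ∃ λ X → Transversal X × p ≢ 0ᵛ × p ∈ᶜ X
transversalThrough {p = p} (p≢⊤ , i , j , i≢j , pᵢ , pⱼ) =
  code p e p≢0 e≢0 p≢e cover ,
  ⊤∉code p≢0 e≢0 p≢e cover p≢⊤ (≢0⇒∁≢⊤ (⁅⁆≢0 i)) (missing⇒≢⊤ (p + e)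
    (trans (lookup-+ p e j) (cong₂ _xor_ pⱼ (trans (lookup-∁ ⁅ i ⁆ j) (cong not (lookup-⁅⁆-≢ i≢j)))))) ,
  p≢0 , ∈span₁ p e
  where
  e = ∁ ⁅ i ⁆
  eᵢ : lookup e i ≡ false
  eᵢ = trans (lookup-∁ ⁅ i ⁆ i) (cong not (lookup-⁅⁆ i))
  e≢0 = ≢⊤⇒∁≢0 (missing⇒≢⊤ ⁅ i ⁆ (lookup-⁅⁆-≢ i≢j))
  p≢0 : p ≢ 0ᵛ
  p≢0 p≡0 = contradiction (trans (sym pᵢ) (trans (cong (λ v → lookup v i) p≡0) (Vec.lookup-replicate i false))) λ ()
  p≢e : p ≢ e
  p≢e p≡e = contradiction (trans (sym pᵢ) (trans (cong (λ v → lookup v i) p≡e) eᵢ)) λ ()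
  cover : ∀ k → lookup p k ≡ false → lookup e k ≡ true
  cover k pₖ = trans (lookup-∁ ⁅ i ⁆ k) (cong not (lookup-⁅⁆-≢ λ i≡k →
    contradiction (trans (sym pᵢ) (trans (cong (lookup p) i≡k) pₖ)) λ ()))

abstract
  -- A vector that lies on a transversal together with its complement: each has two of the four
  -- guaranteed coordinates.
  firstTwo : ∀ m → V (4 ℕ.+ m)
  firstTwo m = ⁅ zero ⁆ + ⁅ suc zero ⁆

  firstTwo-proper : ∀ m → Proper (firstTwo m)
  firstTwo-proper m = (λ ()) , λ ()

  firstTwo-on : ∀ m → OnTransversal (firstTwo m)
  firstTwo-on m = (λ ()) , zero , suc zero , (λ ()) , refl , refl

  ∁firstTwo-on : ∀ m → OnTransversal (∁ (firstTwo m))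
  ∁firstTwo-on m = (λ ()) , suc (suc zero) , suc (suc (suc zero)) , (λ ()) , refl , refl

singleton-or-onTransversal : Proper p → (∃ λ i → p ≡ ⁅ i ⁆) ⊎ OnTransversal p
singleton-or-onTransversal {p = p} (p≢0 , p≢⊤) with nonempty p≢0
... | i , i∈p with p ≟ᵛ ⁅ i ⁆
... | yes p≡⁅i⁆ = inj₁ (i , p≡⁅i⁆)
... | no p≢⁅i⁆ with nonempty (≢⇒+≢0 p≢⁅i⁆)
... | j , j∈ = inj₂ (p≢⊤ , i , j , i≢j , pᵢ , pⱼ)
  where
  pᵢ : lookup p i ≡ true
  pᵢ = Vec.[]=⇒lookup i∈p
  p+iⱼ : lookup p j xor lookup ⁅ i ⁆ j ≡ true
  p+iⱼ = trans (sym (lookup-+ p ⁅ i ⁆ j)) (Vec.[]=⇒lookup j∈)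
  i≢j : i ≢ j
  i≢j refl = contradiction (trans (sym p+iⱼ) (cong₂ _xor_ pᵢ (lookup-⁅⁆ i))) λ ()
  pⱼ : lookup p j ≡ true
  pⱼ = trans (sym (Bool.xor-identityʳ _)) (trans (cong (lookup p j xor_) (sym (lookup-⁅⁆-≢ i≢j))) p+iⱼ)

∁⁅⁆-onTransversal : ∀ (i : Fin (3 ℕ.+ m)) → OnTransversal (∁ ⁅ i ⁆)
∁⁅⁆-onTransversal i = ≢0⇒∁≢⊤ (⁅⁆≢0 i) , two i
  where
  two : ∀ {m} (i : Fin (3 ℕ.+ m)) → ∃₂ λ j k → j ≢ k × lookup (∁ ⁅ i ⁆) j ≡ true × lookup (∁ ⁅ i ⁆) k ≡ true
  two zero          = suc zero , suc (suc zero) , (λ ()) , refl , refl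
  two (suc zero)    = zero , suc (suc zero) , (λ ()) , refl , refl
  two (suc (suc i)) = zero , suc zero , (λ ()) , refl , refl

-- Codes through ⊤ with concurrent images

module Concurrent {m : ℕ} (f : SubgraphIsomorphism (ΓCodes (4 ℕ.+ m)) (Γ₂ (4 ℕ.+ m)))
  (q : V (4 ℕ.+ m)) (q≢0 : q ≢ 0ᵛ)
  (q∈ : ∀ p → q ∈ᵖ SubgraphIsomorphism.to f (pencil p)) where

  private
    N = 4 ℕ.+ m
  open module f = SubgraphIsomorphism f using (to)

  infix 4 _≈ᶜ_
  _≈ᶜ_ : Code N → Code N → Set
  X ≈ᶜ Y = inclusion X ≈ inclusion Y

  to-cong : ∀ X Y → X ≈ᶜ Y → to X ≈ to Y
  to-cong X Y = f.cong {X} {Y}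

  to-injective : ∀ X Y → to X ≈ to Y → X ≈ᶜ Y
  to-injective X Y = f.injective {X} {Y}

  to-common : ∀ X Y {p} → ¬ X ≈ᶜ Y → p ≢ 0ᵛ → p ∈ᶜ X → p ∈ᶜ Y →
              ∃ λ x → x ≢ 0ᵛ × x ∈ᵖ to X × x ∈ᵖ to Y
  to-common X Y X≉Y p≢0 pX pY = common-point (to X) (to Y)
    (f.adjacent-⇒ {X} {Y} (adjacent (inclusion X) (inclusion Y) X≉Y p≢0 pX pY))

  -- If q were on to X, then to X and the images of the 2 ^ (N - 1) - 1 codes
  -- through ⊤ would be too many planes through q.
  module _ (X : Code N) (⊤∉X : Transversal X) (qX : q ∈ᵖ to X) where
    -- Each code through `⊤` has exactly one proper vector with first coordinate 0, so non-zero `t`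
    -- enumerate these codes. The free index `0` is given to `X`.
    family : (t : V (3 ℕ.+ m)) → Dec (t ≡ 0ᵛ) → Code N
    family t (yes _) = X
    family t (no _)  = pencil (false ∷ t)

    q∈family : ∀ t d → q ∈ᵖ to (family t d)
    q∈family t (yes _) = qX
    q∈family t (no _)  = q∈ (false ∷ t)

    family-injective : ∀ s t d e → family s d ≈ᶜ family t e → s ≡ t
    family-injective s t (yes refl) (yes refl) _ = refl
    family-injective s t (yes _) (no _) (_ , ⊑X) = contradiction (⊑X (⊤∈pencil (false ∷ t))) ⊤∉X
    family-injective s t (no _) (yes _) (⊑X , _) = contradiction (⊑X (⊤∈pencil (false ∷ s))) ⊤∉X
    family-injective s t (no s≢0) (no t≢0) eq
      with pencil-≡ {p = false ∷ s} {q = false ∷ t}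
             (s≢0 ∘ cong tail , λ ()) (t≢0 ∘ cong tail , λ ()) eq
    ... | inj₁ refl = refl

    line : V (3 ℕ.+ m) → Plane N
    line t = to (family t (t ≟ᵛ 0ᵛ))

    line-injective : ∀ s t → line s ≈ line t → s ≡ t
    line-injective s t eq = family-injective s t (s ≟ᵛ 0ᵛ) (t ≟ᵛ 0ᵛ)
      (to-injective (family s (s ≟ᵛ 0ᵛ)) (family t (t ≟ᵛ 0ᵛ)) eq)

    point : ∀ t → ∃ λ r → r ≢ 0ᵛ × r ≢ q × r ∈ᵖ line t
    point t = another-point (line t) q

    -- For `c` = 0, 1 these are the two vectors of `line t` other than `0` and `q`. Distinct lines
    -- share only `0` and `q`, so `Ψ` is injective and misses `0`, which is impossible on a finite
    -- set.
    Ψ : V N → V N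
    Ψ (c ∷ t) = proj₁ (point t) + c · q

    ·q-injective : ∀ c d → c · q ≡ d · q → c ≡ d
    ·q-injective false false _  = refl
    ·q-injective true  true  _  = refl
    ·q-injective false true  eq = contradiction (trans (sym (·-identityˡ q)) (trans (sym eq) (·-zeroˡ q))) q≢0
    ·q-injective true  false eq = contradiction (trans (sym (·-identityˡ q)) (trans eq (·-zeroˡ q))) q≢0

    Ψ-injective : Injective _≡_ _≡_ Ψ
    Ψ-injective {c ∷ s} {d ∷ t} eq = same-line (line-injective s t
      (plane-unique (line s) (line t) q≢0 z≢0 (z≢q ∘ sym) qs z∈s (q∈family t (t ≟ᵛ 0ᵛ)) z∈t))
      where
      z = proj₁ (point t)
      z≢0 = proj₁ (proj₂ (point t))
      z≢q = proj₁ (proj₂ (proj₂ (point t)))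
      z∈t = proj₂ (proj₂ (proj₂ (point t)))
      qs  = q∈family s (s ≟ᵛ 0ᵛ)

      z∈s : z ∈ᵖ line s
      z∈s = subst (_∈ᵖ line s) (trans (cong (_+ d · q) eq) (+-cancel z (d · q)))
        (+-closed L (+-closed L (proj₂ (proj₂ (proj₂ (point s)))) (·-closed L c qs)) (·-closed L d qs))
        where L = proj₁ (line s)

      same-line : s ≡ t → c ∷ s ≡ d ∷ t
      same-line refl = cong (_∷ s) (·q-injective c d (+-injectiveʳ z eq))

    Ψ≢0 : ∀ u → Ψ u ≢ 0ᵛ
    Ψ≢0 (false ∷ t) eq = proj₁ (proj₂ (point t))
      (trans (sym (trans (cong (proj₁ (point t) +_) (·-zeroˡ q)) (+.identityʳ _))) eq)
    Ψ≢0 (true  ∷ t) eq = proj₁ (proj₂ (proj₂ (point t)))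
      (trans (≡⇐+≡0 eq) (·-identityˡ q))

    q∈transversal-absurd : ⊥
    q∈transversal-absurd = let u , eq = injective⇒surjective Ψ-injective 0ᵛ in Ψ≢0 u eq

  q∉ : ∀ X → Transversal X → ¬ q ∈ᵖ to X
  q∉ = q∈transversal-absurd

  -- Points over the vectors of a transversal

  transversal≉pencil : ∀ X p → Transversal X → ¬ X ≈ᶜ pencil p
  transversal≉pencil X p ⊤∉X (_ , pencil⊑X) = ⊤∉X (pencil⊑X (⊤∈pencil p))

  to-transversal≉ : ∀ X p → Transversal X → ¬ to X ≈ to (pencil p)
  to-transversal≉ X p ⊤∉X (_ , pencil⊑X) = q∉ X ⊤∉X (pencil⊑X (q∈ p))

  pencils≉ : ∀ X → Transversal X → p ≢ 0ᵛ → r ≢ 0ᵛ → p ≢ r → p ∈ᶜ X → r ∈ᶜ X →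
             ¬ pencil p ≈ᶜ pencil r
  pencils≉ {p} {r} X ⊤∉X p≢0 r≢0 p≢r pX rX eq with
    pencil-≡ (transversal-proper X ⊤∉X p≢0 pX) (transversal-proper X ⊤∉X r≢0 rX) eq
  ... | inj₁ r≡p    = p≢r (sym r≡p)
  ... | inj₂ r≡⊤+p = ⊤∉X (subst (_∈ᶜ X) (trans (cong (_+ p) r≡⊤+p) (+-cancel ⊤ p)) (+-closed ⟦ X ⟧ rX pX))

  -- The candidate for `ψ p` as seen from `X`.
  record Over (X : Code N) (p x : V N) : Set where
    field
      nonzero  : x ≢ 0ᵛ
      ∈image   : x ∈ᵖ to X
      ∈pencilᵖ : x ∈ᵖ to (pencil p)
  open Over

  over : ∀ X → Transversal X → p ≢ 0ᵛ → p ∈ᶜ X → ∃ (Over X p)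
  over {p} X ⊤∉X p≢0 pX = let x , x≢0 , xX , xp = to-common X (pencil p) (transversal≉pencil X p ⊤∉X) p≢0 pX (∈pencil p) in
    x , record { nonzero = x≢0 ; ∈image = xX ; ∈pencilᵖ = xp }

  over-unique : ∀ X → Transversal X → Over X p x → Over X p y → x ≡ y
  over-unique {p} X ⊤∉X ox oy = common-unique (to X) (to (pencil p)) (to-transversal≉ X p ⊤∉X)
    (nonzero ox) (nonzero oy) (∈image ox) (∈pencilᵖ ox) (∈image oy) (∈pencilᵖ oy)

  over≢q : ∀ X → Transversal X → Over X p x → x ≢ q
  over≢q X ⊤∉X o refl = q∉ X ⊤∉X (∈image o)

  -- The images of both pencils contain `q` and `x`, which are distinct, so they coincide, and `f`
  -- is injective.
  over-pencil-≈ : ∀ X Y → Transversal X → Over X p x → Over Y r x → pencil p ≈ᶜ pencil r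
  over-pencil-≈ {p} {r = r} X _ ⊤∉X o o′ = to-injective (pencil p) (pencil r)
    (plane-unique (to (pencil p)) (to (pencil r)) q≢0 (nonzero o) (over≢q X ⊤∉X o ∘ sym)
      (q∈ p) (∈pencilᵖ o) (q∈ r) (∈pencilᵖ o′))

  over-distinct : ∀ X → Transversal X → p ≢ 0ᵛ → r ≢ 0ᵛ → p ≢ r → p ∈ᶜ X → r ∈ᶜ X →
                  Over X p x → Over X r y → x ≢ y
  over-distinct X ⊤∉X p≢0 r≢0 p≢r pX rX ox oy refl =
    pencils≉ X ⊤∉X p≢0 r≢0 p≢r pX rX (over-pencil-≈ X X ⊤∉X ox oy)

  -- Points over different vectors of `X` differ, so the point over `p + r` is the third non-zero
  -- vector of the image.
  over-+ : ∀ X → Transversal X → p ≢ 0ᵛ → r ≢ 0ᵛ → p ≢ r → p ∈ᶜ X → r ∈ᶜ X →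
           Over X p x → Over X r y → Over X (p + r) w → w ≡ x + y
  over-+ {p} {r} X ⊤∉X p≢0 r≢0 p≢r pX rX ox oy ow
    with among (to X) (∈image ox) (∈image oy) (∈image ow) (nonzero ox) (nonzero oy)
           (over-distinct X ⊤∉X p≢0 r≢0 p≢r pX rX ox oy)
  ... | inj₁ refl               = contradiction refl (nonzero ow)
  ... | inj₂ (inj₁ refl)        = contradiction refl
    (over-distinct X ⊤∉X p≢0 (≢⇒+≢0 p≢r) (r≢0 ∘ ≡0⇐≡+) pX (+-closed ⟦ X ⟧ pX rX) ox ow)
  ... | inj₂ (inj₂ (inj₁ refl)) = contradiction refl
    (over-distinct X ⊤∉X r≢0 (≢⇒+≢0 p≢r) (p≢0 ∘ ≡0⇐≡+ ∘ flip trans (+.comm p r)) rX (+-closed ⟦ X ⟧ pX rX) oy ow)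
  ... | inj₂ (inj₂ (inj₂ eq))   = eq

  over-surjective : ∀ X → Transversal X → x ≢ 0ᵛ → x ∈ᵖ to X →
                    ∃ λ p → p ≢ 0ᵛ × p ∈ᶜ X × Over X p x
  over-surjective {x} X ⊤∉X x≢0 xX =
    let p , r , (p≢0 , r≢0 , p≢r) , pX , rX = basis (inclusion X)
        p+r≢0 = ≢⇒+≢0 p≢r
        p+rX = +-closed ⟦ X ⟧ pX rX
        y , oy = over X ⊤∉X p≢0 pX
        z , oz = over X ⊤∉X r≢0 rX
        w , ow = over X ⊤∉X p+r≢0 p+rX
        y≢z = over-distinct X ⊤∉X p≢0 r≢0 p≢r pX rX oy oz
    in case among (to X) (∈image oy) (∈image oz) xX (nonzero oy) (nonzero oz) y≢z of λ
      { (inj₁ x≡0)               → contradiction x≡0 x≢0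
      ; (inj₂ (inj₁ refl))        → p , p≢0 , pX , oy
      ; (inj₂ (inj₂ (inj₁ refl))) → r , r≢0 , rX , oz
      ; (inj₂ (inj₂ (inj₂ eq)))   → p + r , p+r≢0 , p+rX ,
          subst (Over X (p + r)) (trans (over-+ X ⊤∉X p≢0 r≢0 p≢r pX rX oy oz ow) (sym eq)) ow
      }

  over-other : ∀ Y X → Over X p x → x ∈ᵖ to Y → Over Y p x
  over-other Y X o xY = record { nonzero = nonzero o ; ∈image = xY ; ∈pencilᵖ = ∈pencilᵖ o }

  module _ (X Y : Code N) (⊤∉X : Transversal X) (⊤∉Y : Transversal Y)
    (p≢0 : p ≢ 0ᵛ) (pX : p ∈ᶜ X) (pY : p ∈ᶜ Y) where

    -- The pencils of `u` and `v` coincide, so `v` is `u` or `∁ u`. If both differ from `p`, the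
    -- former makes `X` and `Y` share two vectors and the latter fails at a coordinate missing from
    -- `p`.
    common-over : ∀ {s u v} → ¬ X ≈ᶜ Y → u ≢ 0ᵛ → u ∈ᶜ X → v ≢ 0ᵛ → v ∈ᶜ Y →
                  Over X u s → Over Y v s → Over X p s × Over Y p s
    common-over {u = u} {v} X≉Y u≢0 uX v≢0 vY ou ov with u ≟ᵛ p | v ≟ᵛ p
    ... | yes refl | _        = ou , over-other Y X ou (∈image ov)
    ... | no _     | yes refl = over-other X Y ov (∈image ou) , ov
    ... | no u≢p   | no v≢p
      with pencil-≡ (transversal-proper X ⊤∉X u≢0 uX) (transversal-proper Y ⊤∉Y v≢0 vY)
             (over-pencil-≈ X Y ⊤∉X ou ov)
    ... | inj₁ refl = contradiction
      (plane-unique (inclusion X) (inclusion Y) p≢0 u≢0 (u≢p ∘ sym) pX uX pY vY) X≉Y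
    ... | inj₂ refl = contradiction (trans (sym vᵢ) (trans (lookup-+ ⊤ u i) (cong₂ _xor_ (lookup-⊤ i) uᵢ))) λ ()
      -- Both u and ∁ u contain the complement of p, so it is empty.
      where
      i,pᵢ = missing (proj₂ (transversal-proper X ⊤∉X p≢0 pX))
      i    = proj₁ i,pᵢ
      uᵢ   = covering X p≢0 u≢0 (u≢p ∘ sym) pX uX i (proj₂ i,pᵢ)
      vᵢ   = covering Y p≢0 v≢0 (v≢p ∘ sym) pY vY i (proj₂ i,pᵢ)

    -- The images of distinct `X` and `Y` share a point `s`, which lies over `p` in both codes; by
    -- uniqueness it is `x` as well as `y`.
    over-independent : Over X p x → Over Y p y → x ≡ y
    over-independent ox oy with inclusion X ≈? inclusion Y
    ... | yes X≈Y = over-unique X ⊤∉X ox (over-other X Y oy (proj₂ (to-cong X Y X≈Y) (∈image oy)))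
    ... | no X≉Y =
      let s , s≢0 , sX , sY  = to-common X Y X≉Y p≢0 pX pY
          u , u≢0 , uX , ou  = over-surjective X ⊤∉X s≢0 sX
          v , v≢0 , vY , ov  = over-surjective Y ⊤∉Y s≢0 sY
          osX , osY          = common-over X≉Y u≢0 uX v≢0 vY ou ov
      in trans (over-unique X ⊤∉X ox osX) (over-unique Y ⊤∉Y osY oy)

  abstract
    -- One transversal through `p` fixes the point for all of them. A vector on no transversal
    -- receives the default `0`.
    pointOver : ∀ p → ∃ λ x → ∀ X → Transversal X → p ≢ 0ᵛ → p ∈ᶜ X → Over X p x
    pointOver p with onTransversal? p
    ... | no ¬on = 0ᵛ , λ X ⊤∉X p≢0 pX → contradiction (transversal-on X ⊤∉X p≢0 pX) ¬on
    ... | yes on with transversalThrough on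
    ... | Y , ⊤∉Y , p≢0 , pY with over Y ⊤∉Y p≢0 pY
    ... | y , oy = y , λ X ⊤∉X _ pX → let x , ox = over X ⊤∉X p≢0 pX in
      subst (Over X p) (over-independent X Y ⊤∉X ⊤∉Y p≢0 pX pY ox oy) ox

  ψ : V N → V N
  ψ p = proj₁ (pointOver p)

  ψ-over : ∀ X → Transversal X → p ≢ 0ᵛ → p ∈ᶜ X → Over X p (ψ p)
  ψ-over {p} = proj₂ (pointOver p)

  -- The non-zero vectors of a transversal are ∁ A, ∁ B and ∁ C for a partition
  -- of the coordinates into non-empty parts A, B and C.
  K : V N → V N
  K A = ψ (∁ A)

  -- The code `X` spanned by `∁ A` and `∁ B` is non-degenerate because `A` and `B` are disjoint, and
  -- its third vector is `A + B`, the complement of the third part.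
  K-+ : ∀ {A B} → A ≢ 0ᵛ → B ≢ 0ᵛ → Disjoint A B → A + B ≢ ⊤ → K A + K B ≡ K (∁ (A + B))
  K-+ {A} {B} A≢0 B≢0 A#B@(disjoint never-both) A+B≢⊤ = begin
    ψ (∁ A) + ψ (∁ B)    ≡⟨ over-+ X ⊤∉X ∁A≢0 ∁B≢0 ∁A≢∁B ∁A∈ ∁B∈ (ψ-over X ⊤∉X ∁A≢0 ∁A∈) (ψ-over X ⊤∉X ∁B≢0 ∁B∈)
                             (ψ-over X ⊤∉X (≢⇒+≢0 ∁A≢∁B) (+-closed ⟦ X ⟧ ∁A∈ ∁B∈)) ⟨
    ψ (∁ A + ∁ B)        ≡⟨ cong ψ (trans ∁+∁ (sym (∁-involutive (A + B)))) ⟩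
    ψ (∁ (∁ (A + B)))    ∎
    where
    open ≡-Reasoning
    ∁+∁ : ∁ A + ∁ B ≡ A + B
    ∁+∁ = trans (cong₂ _+_ (∁≡⊤+ A) (∁≡⊤+ B))
      (trans (+.interchange ⊤ A ⊤ B) (trans (cong (_+ (A + B)) (+-same ⊤)) (+.identityˡ _)))

    ≢⊤ : ∀ {C D : V N} → D ≢ 0ᵛ → Disjoint C D → C ≢ ⊤
    ≢⊤ D≢0 (disjoint nb) refl = let i , i∈D = nonempty D≢0 in nb i (lookup-⊤ i) (Vec.[]=⇒lookup i∈D)

    ∁A≢0 = ≢⊤⇒∁≢0 (≢⊤ B≢0 A#B)
    ∁B≢0 = ≢⊤⇒∁≢0 (≢⊤ A≢0 (Disjoint-sym A#B))
    ∁A≢∁B : ∁ A ≢ ∁ B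
    ∁A≢∁B = Disjoint⇒≢ A≢0 A#B ∘ ∁-injective

    cover : ∀ i → lookup (∁ A) i ≡ false → lookup (∁ B) i ≡ true
    cover i ∁Aᵢ = trans (lookup-∁ B i) (cong not (Bool.¬-not
      (never-both i (Bool.not-injective (trans (sym (lookup-∁ A i)) ∁Aᵢ)))))

    X = code (∁ A) (∁ B) ∁A≢0 ∁B≢0 ∁A≢∁B cover
    ⊤∉X : Transversal X
    ⊤∉X = ⊤∉code ∁A≢0 ∁B≢0 ∁A≢∁B cover (≢0⇒∁≢⊤ A≢0) (≢0⇒∁≢⊤ B≢0) (A+B≢⊤ ∘ trans (sym ∁+∁))
    ∁A∈ = ∈span₁ (∁ A) (∁ B)
    ∁B∈ = ∈span₂ (∁ A) (∁ B)

  -- The linear map through the points `ψ p`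

  open PartitionSums {m = m} K K-+ using (F; F-+; F-⊤; K≡F∁)

  -- The two coordinates at which `p` is 1 are the two that `K≡F∁` requires `∁ p` to omit.
  F≡ψ : OnTransversal p → F p ≡ ψ p
  F≡ψ {p} (p≢⊤ , i , j , i≢j , pᵢ , pⱼ) = begin
    F p            ≡⟨ cong F (∁-involutive p) ⟨
    F (∁ (∁ p))    ≡⟨ K≡F∁ (∁ p) (≢⊤⇒∁≢0 p≢⊤) i≢j (∁-false i pᵢ) (∁-false j pⱼ) ⟨
    ψ (∁ (∁ p))    ≡⟨ cong ψ (∁-involutive p) ⟩
    ψ p            ∎
    where
    open ≡-Reasoning
    ∁-false : ∀ k → lookup p k ≡ true → lookup (∁ p) k ≡ false
    ∁-false k pₖ = trans (lookup-∁ p k) (cong not pₖ)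

  F-over : ∀ X → Transversal X → p ≢ 0ᵛ → p ∈ᶜ X → Over X p (F p)
  F-over {p} X ⊤∉X p≢0 pX =
    subst (Over X p) (sym (F≡ψ (transversal-on X ⊤∉X p≢0 pX))) (ψ-over X ⊤∉X p≢0 pX)

  record OverPencil (p x : V N) : Set where
    field
      pencil∋ : x ∈ᵖ to (pencil p)
      ≢0      : x ≢ 0ᵛ
      ≢q      : x ≢ q
  open OverPencil

  onTransversal⇒overPencil : OnTransversal p → OverPencil p (F p)
  onTransversal⇒overPencil {p} on with transversalThrough on
  ... | X , ⊤∉X , p≢0 , pX = let o = F-over X ⊤∉X p≢0 pX in
    record { pencil∋ = ∈pencilᵖ o ; ≢0 = nonzero o ; ≢q = over≢q X ⊤∉X o }

  to-pencil-∁ : Proper p → x ∈ᵖ to (pencil (∁ p)) → x ∈ᵖ to (pencil p)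
  to-pencil-∁ {p} pr = proj₂ (to-cong (pencil p) (pencil (∁ p)) (∁-pencil pr))

  F-⊤-split : ∀ p → F ⊤ ≡ F p + F (∁ p)
  F-⊤-split p = trans (cong F (begin
    ⊤              ≡⟨ +-cancel ⊤ p ⟨
    (⊤ + p) + p    ≡⟨ +.comm _ p ⟩
    p + (⊤ + p)    ≡⟨ cong (p +_) (∁≡⊤+ p) ⟨
    p + ∁ p        ∎)) (F-+ p (∁ p))
    where open ≡-Reasoning

  -- The pencils of `p` and `∁ p` are equal, so `F (∁ p)` lies in the plane of `q` and `F p`. Being
  -- neither `0` nor `q`, it is `F p` or `q + F p`.
  F-⊤-cases : ∀ p → Proper p → OverPencil p (F p) → OverPencil (∁ p) (F (∁ p)) → F ⊤ ≡ 0ᵛ ⊎ F ⊤ ≡ q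
  F-⊤-cases p pr o o′ with among (to (pencil p)) (q∈ p) (pencil∋ o) (to-pencil-∁ pr (pencil∋ o′))
                        q≢0 (≢0 o) (≢q o ∘ sym)
  ... | inj₁ eq               = contradiction eq (≢0 o′)
  ... | inj₂ (inj₁ eq)        = contradiction eq (≢q o′)
  ... | inj₂ (inj₂ (inj₁ eq)) = inj₁ (trans (F-⊤-split p) (trans (cong (F p +_) eq) (+-same (F p))))
  ... | inj₂ (inj₂ (inj₂ eq)) = inj₂ (trans (F-⊤-split p)
    (trans (cong (F p +_) (trans eq (+.comm q (F p)))) (+-cancelˡ (F p) q)))

  abstract
    F-⊤-dichotomy : F ⊤ ≡ 0ᵛ ⊎ F ⊤ ≡ q
    F-⊤-dichotomy = F-⊤-cases (firstTwo m) (firstTwo-proper m)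
      (onTransversal⇒overPencil (firstTwo-on m)) (onTransversal⇒overPencil (∁firstTwo-on m))

  F-⊤∈ : ∀ (X : Plane N) → q ∈ᵖ X → F ⊤ ∈ᵖ X
  F-⊤∈ X qX with F-⊤-dichotomy
  ... | inj₁ eq = subst (_∈ᵖ X) (sym eq) (0-closed (proj₁ X))
  ... | inj₂ eq = subst (_∈ᵖ X) (sym eq) qX

  F-⊤+≢ : x ≢ 0ᵛ → x ≢ q → F ⊤ + x ≢ 0ᵛ × F ⊤ + x ≢ q
  F-⊤+≢ {x} x≢0 x≢q with F-⊤-dichotomy
  ... | inj₁ eq = subst (λ y → y + x ≢ 0ᵛ × y + x ≢ q) (sym eq)
    ((x≢0 ∘ trans (sym (+.identityˡ x))) , (x≢q ∘ trans (sym (+.identityˡ x))))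
  ... | inj₂ eq = subst (λ y → y + x ≢ 0ᵛ × y + x ≢ q) (sym eq)
    ((x≢q ∘ sym ∘ ≡⇐+≡0) , (x≢0 ∘ ≡0⇐≡+ ∘ sym))

  -- A singleton lies on no transversal, but its complement does. Adding `F ⊤`, which is `0` or `q`,
  -- stays in the plane and avoids `0` and `q`.
  F-overPencil : Proper p → OverPencil p (F p)
  F-overPencil {p} pr with singleton-or-onTransversal pr
  ... | inj₂ on         = onTransversal⇒overPencil on
  ... | inj₁ (i , refl) = subst (OverPencil p) F-⊤+F record
    { pencil∋ = +-closed (proj₁ (to (pencil p))) (F-⊤∈ (to (pencil p)) (q∈ p)) (to-pencil-∁ pr (pencil∋ o))
    ; ≢0      = proj₁ (F-⊤+≢ (≢0 o) (≢q o))
    ; ≢q      = proj₂ (F-⊤+≢ (≢0 o) (≢q o))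
    }
    where
    o : OverPencil (∁ p) (F (∁ p))
    o = onTransversal⇒overPencil (∁⁅⁆-onTransversal i)
    F-⊤+F : F ⊤ + F (∁ p) ≡ F p
    F-⊤+F = trans (cong (_+ F (∁ p)) (F-⊤-split p)) (+-cancel (F p) (F (∁ p)))

  q∈image : ∀ X → ⊤ ∈ᶜ X → q ∈ᵖ to X
  q∈image X ⊤X with another-point (inclusion X) ⊤
  ... | p , p≢0 , p≢⊤ , pX = proj₂ (to-cong X (pencil p) (pencil-unique X (p≢0 , p≢⊤) ⊤X pX)) (q∈ p)

  F∈image : ∀ X → p ∈ᶜ X → F p ∈ᵖ to X
  F∈image {p} X pX with p ≟ᵛ 0ᵛ | p ≟ᵛ ⊤ | ∈ᵖ? (inclusion X) ⊤
  ... | yes refl | _        | _      = subst (_∈ᵖ to X) (sym (additive-0 F-+)) (0-closed (proj₁ (to X)))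
  ... | no _     | yes refl | _      = F-⊤∈ (to X) (q∈image X pX)
  ... | no p≢0   | no p≢⊤   | yes ⊤X =
    proj₂ (to-cong X (pencil p) (pencil-unique X (p≢0 , p≢⊤) ⊤X pX)) (pencil∋ (F-overPencil (p≢0 , p≢⊤)))
  ... | no p≢0   | no _     | no ⊤∉X = ∈image (F-over X ⊤∉X p≢0 pX)

  -- Comparison of `f` with linear automorphisms

  module Agreement (G : V N → V N) (G-+ : Additive G) (G-ker : ∀ v → G v ≡ 0ᵛ → v ≡ 0ᵛ) where

    G-injective : Injective _≡_ _≡_ G
    G-injective = additive-injective G-+ (G-ker _)

    G⁻¹ : V N → V N
    G⁻¹ v = proj₁ (injective⇒surjective G-injective v)

    G∘G⁻¹ : ∀ v → G (G⁻¹ v) ≡ v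
    G∘G⁻¹ v = proj₂ (injective⇒surjective G-injective v)

    G⁻¹∘G : ∀ v → G⁻¹ (G v) ≡ v
    G⁻¹∘G v = G-injective (G∘G⁻¹ (G v))

    automorphism : Automorphism (Γ₂ N)
    automorphism = linearAutomorphism G G⁻¹ G-+ G∘G⁻¹ G⁻¹∘G

    -- An injective additive map sends a basis of `Y` to a basis of the image plane, so inclusion in
    -- `W` already gives equality.
    agree : (W Y : Plane N) → (∀ {u} → u ∈ᵖ Y → G u ∈ᵖ W) → W ≈ Automorphism.to automorphism Y
    agree W Y G∈W = let u , v , (u≢0 , v≢0 , u≢v) , uY , vY = basis Y in
      plane-unique W (Automorphism.to automorphism Y) (u≢0 ∘ G-ker u) (v≢0 ∘ G-ker v) (u≢v ∘ G-injective)
        (G∈W uY) (G∈W vY) (subst (_∈ᵖ Y) (sym (G⁻¹∘G u)) uY) (subst (_∈ᵖ Y) (sym (G⁻¹∘G v)) vY)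

  extension : F ⊤ ≡ q → ∃ λ (g : Automorphism (Γ₂ N)) → Extends g f
  extension F⊤≡q = automorphism , λ X → agree (to X) (inclusion X) (F∈image X)
    where
    F-ker : ∀ v → F v ≡ 0ᵛ → v ≡ 0ᵛ
    F-ker v Fv≡0 with v ≟ᵛ 0ᵛ | v ≟ᵛ ⊤
    ... | yes v≡0 | _        = v≡0
    ... | no _    | yes refl = contradiction (trans (sym F⊤≡q) Fv≡0) q≢0
    ... | no v≢0  | no v≢⊤   = contradiction Fv≡0 (≢0 (F-overPencil (v≢0 , v≢⊤)))
    open Agreement F F-+ F-ker

  module Projection (F⊤≡0 : F ⊤ ≡ 0ᵛ) where

    G : V N → V N
    G v = F v + χ v · q

    G-+ : Additive G
    G-+ u v = trans (cong₂ _+_ (F-+ u v) (trans (cong (_· q) (χ-+ u v)) (·-distribʳ (χ u) (χ v) q)))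
      (+.interchange (F u) (F v) (χ u · q) (χ v · q))

    G-∈H : v ∈ H → G v ≡ F v
    G-∈H {v} v∈H = trans (cong (λ a → F v + a · q) (χ-∈ v∈H)) (trans (cong (F v +_) (·-zeroˡ q)) (+.identityʳ (F v)))

    -- As `F ⊤` is `0`, `F` agrees at `v` and `∁ v`, and on the member `∁ v` of `H` the maps `G` and
    -- `F` coincide.
    G-∁ : ¬ v ∈ H → G (∁ v) ≡ F v
    G-∁ {v} v∉H = begin
      G (∁ v)        ≡⟨ G-∈H (∉H⇒∁∈H v∉H) ⟩
      F (∁ v)        ≡⟨ x+y≡z⇒y≡x+z (sym (F-⊤-split v)) ⟩
      F v + F ⊤      ≡⟨ cong (F v +_) F⊤≡0 ⟩
      F v + 0ᵛ       ≡⟨ +.identityʳ (F v) ⟩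
      F v            ∎
      where open ≡-Reasoning

    F≢·q : Proper v → ∀ a → F v + a · q ≢ 0ᵛ
    F≢·q pr false eq = ≢0 (F-overPencil pr) (trans (≡⇐+≡0 eq) (·-zeroˡ q))
    F≢·q pr true  eq = ≢q (F-overPencil pr) (trans (≡⇐+≡0 eq) (·-identityˡ q))

    G⊤≡q : G ⊤ ≡ q
    G⊤≡q = trans (cong₂ _+_ F⊤≡0 (trans (cong (_· q) (χ-∉ {v = ⊤ {N}} ⊤∉H)) (·-identityˡ q))) (+.identityˡ q)

    G-ker : ∀ v → G v ≡ 0ᵛ → v ≡ 0ᵛ
    G-ker v Gv≡0 with v ≟ᵛ 0ᵛ | v ≟ᵛ ⊤
    ... | yes v≡0 | _        = v≡0
    ... | no _    | yes refl = contradiction (trans (sym G⊤≡q) Gv≡0) q≢0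
    ... | no v≢0  | no v≢⊤   = contradiction Gv≡0 (F≢·q (v≢0 , v≢⊤) (χ v))

    open Agreement G G-+ G-ker

    -- On `𝒜` the correction by `q` stays in `to X`, and on `ℬ` there is none. On `𝒞` the generators
    -- `∁ I` and `∁ J` of the complement go to `F I` and `F J`.
    G-h : ∀ X d → proj₁ (image X d) ⊑ comap {g = G} G-+ (proj₁ (to X))
    G-h X (yes (inj₁ Q⊑X)) {u} uX = +-closed (proj₁ (to X)) (F∈image X uX)
      (·-closed (proj₁ (to X)) (χ u) (q∈image X (Q⊑X (∈P ⊤))))
    G-h X (yes (inj₂ X⊑H)) uX = subst (_∈ᵖ to X) (sym (G-∈H (X⊑H uX))) (F∈image X uX)
    G-h X (no X∈𝒞) with outsidePair X X∈𝒞
    ... | I , J , o = +ₛ-least (Pᶜ I) (Pᶜ J) Z (P⊑ Z (outside I⊑X I⋢H)) (P⊑ Z (outside J⊑X J⋢H))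
      where
      open OutsidePair o
      Z = comap {g = G} G-+ (proj₁ (to X))
      outside : ∀ {I} → P I ⊑ ⟦ X ⟧ → ¬ P I ⊑ H → G (∁ I) ∈ᵖ to X
      outside {I} I⊑X I⋢H = subst (_∈ᵖ to X) (sym (G-∁ λ I∈H → I⋢H (P⊑ (H {N}) I∈H))) (F∈image X (I⊑X (∈P I)))

    agree-image : ∀ X d → to X ≈ Automorphism.to automorphism (image X d)
    agree-image X d = agree (to X) (image X d) (G-h X d)

    factorisation : ∃ λ (g : Automorphism (Γ₂ N)) → ∀ X → to X ≈ Automorphism.to g (Func.to h X)
    factorisation = automorphism , λ X → agree-image X (𝒜⊎ℬ? X)

  extension-or-factorisation :
    (∃ λ (g : Automorphism (Γ₂ N)) → Extends g f) ⊎
    (∃ λ (g : Automorphism (Γ₂ N)) → ∀ X → to X ≈ Automorphism.to g (Func.to h X))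
  extension-or-factorisation =
    [ (λ F⊤≡0 → inj₂ (Projection.factorisation F⊤≡0)) , (λ F⊤≡q → inj₁ (extension F⊤≡q)) ]′ F-⊤-dichotomy

-- Concurrent and coplanar images

infixr 9 _∘ᴬ_
_∘ᴬ_ : ∀ {c ℓ s} {G : Graph c ℓ s} → Automorphism G → Automorphism G → Automorphism G
g₂ ∘ᴬ g₁ = record
  { bijection  = inverse g₁.bijection g₂.bijection
  ; adjacent-⇔ = λ x y → equivalence (g₁.adjacent-⇔ x y) (g₂.adjacent-⇔ (g₁.to x) (g₁.to y))
  }
  where
  module g₁ = Automorphism g₁
  module g₂ = Automorphism g₂

module _ {m : ℕ} (f : SubgraphIsomorphism (ΓCodes (4 ℕ.+ m)) (Γ₂ (4 ℕ.+ m))) where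

  private
    N = 4 ℕ.+ m
    module f = SubgraphIsomorphism f

  pencilImage : V N → Plane N
  pencilImage p = f.to (pencil p)

  pencilImage-injective : ∀ p r → pencilImage p ≈ pencilImage r → inclusion (pencil p) ≈ inclusion (pencil r)
  pencilImage-injective p r = f.injective {pencil p} {pencil r}

  meet : ∀ p r → ∃ λ x → x ≢ 0ᵛ × x ∈ᵖ pencilImage p × x ∈ᵖ pencilImage r
  meet p r with inclusion (pencil p) ≈? inclusion (pencil r)
  ... | yes eq = let x , x≢0 , _ , xp = another-point (pencilImage p) 0ᵛ in
    x , x≢0 , xp , proj₁ (f.cong {pencil p} {pencil r} eq) xp
  ... | no ≉   = common-point (pencilImage p) (pencilImage r) (f.adjacent-⇒ {pencil p} {pencil r}
    (adjacent (inclusion (pencil p)) (inclusion (pencil r)) ≉ ⊤≢0 (⊤∈pencil p) (⊤∈pencil r)))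

  Concurrently : Set
  Concurrently = ∃ λ q → q ≢ 0ᵛ × ∀ p → q ∈ᵖ pencilImage p

  Meets : V N → V N → Set
  Meets u v = ∀ p → u ∈ᵖ pencilImage p ⊎ v ∈ᵖ pencilImage p ⊎ u + v ∈ᵖ pencilImage p

  -- Three non-collinear points of projective space such that every pencil image meets each of the
  -- three sides.
  record Triangle : Set where
    field
      e a b           : V N
      e≢0             : e ≢ 0ᵛ
      a≢0             : a ≢ 0ᵛ
      b≢0             : b ≢ 0ᵛ
      e≢a             : e ≢ a
      e≢b             : e ≢ b
      a≢b             : a ≢ b
      e≢a+b           : e ≢ a + b
      ea-meets        : Meets e a
      eb-meets        : Meets e b
      ab-meets        : Meets a b

  meets : ∀ r → u ≢ 0ᵛ → v ≢ 0ᵛ → u ≢ v → u ∈ᵖ pencilImage r → v ∈ᵖ pencilImage r → Meets u v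
  meets r u≢0 v≢0 u≢v ur vr p with meet r p
  ... | x , x≢0 , xr , xp with among (pencilImage r) ur vr xr u≢0 v≢0 u≢v
  ... | inj₁ refl               = contradiction refl x≢0
  ... | inj₂ (inj₁ refl)        = inj₁ xp
  ... | inj₂ (inj₂ (inj₁ refl)) = inj₂ (inj₁ xp)
  ... | inj₂ (inj₂ (inj₂ refl)) = inj₂ (inj₂ xp)

  -- Two fixed pencil images meet in `q`. If some third image misses `q`, it meets them in points
  -- `a` and `b`, and each side of the triangle is itself a pencil image.
  concurrently-or-triangle : Concurrently ⊎ Triangle
  concurrently-or-triangle with meet ⁅ zero ⁆ ⁅ suc zero ⁆
  ... | q , q≢0 , qA , qB with anySubset? (λ p → ¬? (∈ᵖ? (pencilImage p) q))
  ... | no none = inj₁ (q , q≢0 , λ p → decidable-stable (∈ᵖ? (pencilImage p) q) λ q∉ → none (p , q∉))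
  ... | yes (p , q∉) with meet ⁅ zero ⁆ p | meet ⁅ suc zero ⁆ p
  ... | a , a≢0 , aA , aM | b , b≢0 , bB , bM = inj₂ record
    { e≢0 = q≢0 ; a≢0 = a≢0 ; b≢0 = b≢0
    ; e≢a = q≢a ; e≢b = q≢b ; a≢b = a≢b
    ; e≢a+b    = λ { refl → q∉ (+-closed (proj₁ (pencilImage p)) aM bM) }
    ; ea-meets = meets ⁅ zero ⁆ q≢0 a≢0 q≢a qA aA
    ; eb-meets = meets ⁅ suc zero ⁆ q≢0 b≢0 q≢b qB bB
    ; ab-meets = meets p a≢0 b≢0 a≢b aM bM
    }
    where
    q≢a : q ≢ a
    q≢a refl = q∉ aM
    q≢b : q ≢ b
    q≢b refl = q∉ bM
    a≢b : a ≢ b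
    a≢b refl with pencil-≡ {p = ⁅ zero ⁆} {q = ⁅ suc zero ⁆} ((λ ()) , λ ()) ((λ ()) , λ ())
                    (pencilImage-injective ⁅ zero ⁆ ⁅ suc zero ⁆
                      (plane-unique (pencilImage ⁅ zero ⁆) (pencilImage ⁅ suc zero ⁆) q≢0 a≢0 q≢a qA aA qB bB))
    ... | inj₁ ()
    ... | inj₂ ()

  -- A plane contained in the span of e, a and b is determined by which of these
  -- three vectors it contains, so at most seven codes contain ⊤ and 3 + m ≤ 3.
  module Coplanar (t : Triangle) where
    open Triangle t

    -- The bits tell which of `e`, `a`, `b` a pencil image contains. When two of these are absent,
    -- their sum is present, since the image meets that side.
    frame : V 3 → V N × V N
    frame (false ∷ false ∷ false ∷ []) = e + a , e + b
    frame (true  ∷ false ∷ false ∷ []) = e , a + b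
    frame (false ∷ true  ∷ false ∷ []) = a , e + b
    frame (false ∷ false ∷ true  ∷ []) = b , e + a
    frame (true  ∷ true  ∷ _     ∷ []) = e , a
    frame (true  ∷ false ∷ true  ∷ []) = e , b
    frame (false ∷ true  ∷ true  ∷ []) = a , b

    frame-distinct : ∀ c → uncurry Distinct (frame c)
    frame-distinct (false ∷ false ∷ false ∷ []) = ≢⇒+≢0 e≢a , ≢⇒+≢0 e≢b , a≢b ∘ +-injectiveʳ e
    frame-distinct (true  ∷ false ∷ false ∷ []) = e≢0 , ≢⇒+≢0 a≢b , e≢a+b
    frame-distinct (false ∷ true  ∷ false ∷ []) = a≢0 , ≢⇒+≢0 e≢b ,
      λ a≡e+b → e≢a+b (trans (x+y≡z⇒y≡x+z (trans (+.comm b e) (sym a≡e+b))) (+.comm b a))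
    frame-distinct (false ∷ false ∷ true  ∷ []) = b≢0 , ≢⇒+≢0 e≢a ,
      λ b≡e+a → e≢a+b (x+y≡z⇒y≡x+z (trans (+.comm a e) (sym b≡e+a)))
    frame-distinct (true  ∷ true  ∷ _     ∷ []) = e≢0 , a≢0 , e≢a
    frame-distinct (true  ∷ false ∷ true  ∷ []) = e≢0 , b≢0 , e≢b
    frame-distinct (false ∷ true  ∷ true  ∷ []) = a≢0 , b≢0 , a≢b

    frame-⊑ : (W : Subspace N) → e ∈ W → a ∈ W → b ∈ W → ∀ c → proj₁ (frame c) ∈ W × proj₂ (frame c) ∈ W
    frame-⊑ W eW aW bW (false ∷ false ∷ false ∷ []) = +-closed W eW aW , +-closed W eW bW
    frame-⊑ W eW aW bW (true  ∷ false ∷ false ∷ []) = eW , +-closed W aW bW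
    frame-⊑ W eW aW bW (false ∷ true  ∷ false ∷ []) = aW , +-closed W eW bW
    frame-⊑ W eW aW bW (false ∷ false ∷ true  ∷ []) = bW , +-closed W eW aW
    frame-⊑ W eW aW bW (true  ∷ true  ∷ _     ∷ []) = eW , aW
    frame-⊑ W eW aW bW (true  ∷ false ∷ true  ∷ []) = eW , bW
    frame-⊑ W eW aW bW (false ∷ true  ∷ true  ∷ []) = aW , bW

    ∉+∉ : Meets u v → ∀ p → ¬ u ∈ᵖ pencilImage p → ¬ v ∈ᵖ pencilImage p → u + v ∈ᵖ pencilImage p
    ∉+∉ meets p u∉ v∉ with meets p
    ... | inj₁ u∈         = contradiction u∈ u∉
    ... | inj₂ (inj₁ v∈)  = contradiction v∈ v∉
    ... | inj₂ (inj₂ u+v∈) = u+v∈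

    type : V N → V 3
    type p = does (∈ᵖ? (pencilImage p) e) ∷ does (∈ᵖ? (pencilImage p) a) ∷ does (∈ᵖ? (pencilImage p) b) ∷ []

    frame-∈ : ∀ p → proj₁ (frame (type p)) ∈ᵖ pencilImage p × proj₂ (frame (type p)) ∈ᵖ pencilImage p
    frame-∈ p with ∈ᵖ? (pencilImage p) e | ∈ᵖ? (pencilImage p) a | ∈ᵖ? (pencilImage p) b
    ... | no e∉  | no a∉  | no b∉  = ∉+∉ ea-meets p e∉ a∉ , ∉+∉ eb-meets p e∉ b∉
    ... | yes e∈ | no a∉  | no b∉  = e∈ , ∉+∉ ab-meets p a∉ b∉
    ... | no e∉  | yes a∈ | no b∉  = a∈ , ∉+∉ eb-meets p e∉ b∉
    ... | no e∉  | no a∉  | yes b∈ = b∈ , ∉+∉ ea-meets p e∉ a∉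
    ... | yes e∈ | yes a∈ | _      = e∈ , a∈
    ... | yes e∈ | no _   | yes b∈ = e∈ , b∈
    ... | no _   | yes a∈ | yes b∈ = a∈ , b∈

    type≢⊤ : ∀ p → type p ≢ ⊤
    type≢⊤ p with ∈ᵖ? (pencilImage p) e | ∈ᵖ? (pencilImage p) a | ∈ᵖ? (pencilImage p) b
    ... | no _   | _      | _      = λ ()
    ... | yes _  | no _   | _      = λ ()
    ... | yes _  | yes _  | no _   = λ ()
    ... | yes e∈ | yes a∈ | yes b∈ with among (pencilImage p) a∈ b∈ e∈ a≢0 b≢0 a≢b
    ... | inj₁ e≡0                 = contradiction e≡0 e≢0
    ... | inj₂ (inj₁ e≡a)          = contradiction e≡a e≢a
    ... | inj₂ (inj₂ (inj₁ e≡b))   = contradiction e≡b e≢b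
    ... | inj₂ (inj₂ (inj₂ e≡a+b)) = contradiction e≡a+b e≢a+b

    type-injective : ∀ p r → type p ≡ type r → inclusion (pencil p) ≈ inclusion (pencil r)
    type-injective p r eq =
      let u≢0 , v≢0 , u≢v = frame-distinct (type p)
          up , vp = frame-∈ p
          ur , vr = subst (λ c → proj₁ (frame c) ∈ᵖ pencilImage r × proj₂ (frame c) ∈ᵖ pencilImage r) (sym eq) (frame-∈ r)
      in pencilImage-injective p r (plane-unique (pencilImage p) (pencilImage r) u≢0 v≢0 u≢v up vp ur vr)

    -- The index `0` goes to `⊤`, a value that `type` never takes, so that all of `V (3 + m)` is
    -- injected into `V 3`.
    type₀ : (t : V (3 ℕ.+ m)) → Dec (t ≡ 0ᵛ) → V 3
    type₀ t (yes _) = ⊤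
    type₀ t (no _)  = type (false ∷ t)

    type₀-injective : ∀ s t d e → type₀ s d ≡ type₀ t e → s ≡ t
    type₀-injective s t (yes refl) (yes refl) _ = refl
    type₀-injective s t (yes _) (no _) eq = contradiction (sym eq) (type≢⊤ (false ∷ t))
    type₀-injective s t (no _) (yes _) eq = contradiction eq (type≢⊤ (false ∷ s))
    type₀-injective s t (no s≢0) (no t≢0) eq
      with pencil-≡ {p = false ∷ s} {q = false ∷ t}
             (s≢0 ∘ cong tail , λ ()) (t≢0 ∘ cong tail , λ ()) (type-injective (false ∷ s) (false ∷ t) eq)
    ... | inj₁ refl = refl

    dimension : 3 ℕ.+ m ≤ 3
    dimension = injective⇒≤-dim {g = λ t → type₀ t (t ≟ᵛ 0ᵛ)}
      λ {s} {t} → type₀-injective s t (s ≟ᵛ 0ᵛ) (t ≟ᵛ 0ᵛ)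

-- The coplanar case in dimension four

dual : SubgraphIsomorphism (ΓCodes 4) (Γ₂ 4) → SubgraphIsomorphism (ΓCodes 4) (Γ₂ 4)
dual f = record
  { injection = record
    { to        = perp ∘ f.to
    ; cong      = λ {X} {Y} eq → perp-cong (f.to X) (f.to Y) (f.cong {X} {Y} eq)
    ; injective = λ {X} {Y} eq → f.injective {X} {Y} (perp-cancel (f.to X) (f.to Y) eq)
    }
  ; adjacent-⇒ = λ {X} {Y} adj → perp-adjacent (f.to X) (f.to Y) (f.adjacent-⇒ {X} {Y} adj)
  }
  where module f = SubgraphIsomorphism f

module _ (f : SubgraphIsomorphism (ΓCodes 4) (Γ₂ 4)) where

  -- All pencil images lie in the span of `e`, `a`, `b`. A non-zero vector `z` orthogonal to these
  -- three lies in the complement of every pencil image.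
  triangle⇒dual-concurrently : Triangle f → Concurrently (dual f)
  triangle⇒dual-concurrently t with ⊥ᵛ-third (Triangle.e≢0 t , Triangle.a≢0 t , Triangle.e≢a t) (Triangle.b t)
  ... | z , z≢0 , e⊥z , a⊥z , b⊥z = z , z≢0 , λ p →
    let u∈ , v∈ = frame-∈ p
        u⊥ , v⊥ = frame-⊑ (P z ^⊥) (∈P^⊥ e⊥z) (∈P^⊥ a⊥z) (∈P^⊥ b⊥z) (type p)
    in ∈^⊥ (pencilImage f p) (frame-distinct (type p)) u∈ v∈ (⊥ᵛ-sym (u⊥ (∈P z))) (⊥ᵛ-sym (v⊥ (∈P z)))
    where
    open Coplanar f t

module _ {m : ℕ} (f : SubgraphIsomorphism (ΓCodes (4 ℕ.+ m)) (Γ₂ (4 ℕ.+ m))) where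

  Extendable Factorable : Set₁
  Extendable = ∃ λ (g : Automorphism (Γ₂ (4 ℕ.+ m))) → Extends g f
  Factorable = ∃ λ (g : Automorphism (Γ₂ (4 ℕ.+ m))) →
    ∀ X → SubgraphIsomorphism.to f X ≈ Automorphism.to g (Func.to h X)

  concurrently⇒ : Concurrently f → Extendable ⊎ Factorable
  concurrently⇒ (q , q≢0 , q∈) = Concurrent.extension-or-factorisation f q q≢0 q∈

-- Duality is an involution, so composing it with the automorphism found for `dual f` gives one for
-- `f`.
undual : (f : SubgraphIsomorphism (ΓCodes 4) (Γ₂ 4)) →
         Extendable (dual f) ⊎ Factorable (dual f) → Extendable f ⊎ Factorable f
undual f =
  [ (λ (g , ext) → inj₁ (duality ∘ᴬ g , λ X → flip-perp (f.to X) (Automorphism.to g (inclusion X)) (ext X)))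
  , (λ (g , fac) → inj₂ (duality ∘ᴬ g , λ X → flip-perp (f.to X) (Automorphism.to g (Func.to h X)) (fac X))) ]′
  where
  module f = SubgraphIsomorphism f
  flip-perp : (X Y : Plane 4) → perp X ≈ Y → X ≈ perp Y
  flip-perp X Y eq = ≈.trans {i = X} {perp (perp X)} {perp Y} (perp-involutive X) (perp-cong (perp X) Y eq)

extendable-or-factorable : (f : SubgraphIsomorphism (ΓCodes (4 ℕ.+ m)) (Γ₂ (4 ℕ.+ m))) → Extendable f ⊎ Factorable f
extendable-or-factorable {m} f = [ concurrently⇒ f , coplanar m f ]′ (concurrently-or-triangle f)
  where
  coplanar : ∀ m (f : SubgraphIsomorphism (ΓCodes (4 ℕ.+ m)) (Γ₂ (4 ℕ.+ m))) → Triangle f → Extendable f ⊎ Factorable f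
  coplanar zero    f t = undual f (concurrently⇒ (dual f) (triangle⇒dual-concurrently f t))
  -- From dimension five on, there are too many codes through `⊤` for the planes of a
  -- three-dimensional space.
  coplanar (suc m) f t = contradiction (Coplanar.dimension f t) (ℕ.m+1+n≰m 3)

theorem4 : (n : ℕ) → 4 ≤ n → (f : SubgraphIsomorphism (ΓCodes n) (Γ₂ n)) →
    ¬ (∃ λ (g : Automorphism (Γ₂ n)) → Extends g f) →
    ∃ λ (g : Automorphism (Γ₂ n)) →
    ∀ (X : Code n) →
    Graph._≈_ (Γ₂ n) (SubgraphIsomorphism.to f X) (Automorphism.to g (Func.to h X))
theorem4 _ (s≤s (s≤s (s≤s (s≤s z≤n)))) f ¬ext =
  [ (λ ext → contradiction ext ¬ext) , id ]′ (extendable-or-factorable f)
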